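{- For every $\varepsilon > 0$ there exists $r_0$ such that for all integers $r > r_0$ we have $\pi_{K_{r,r}}(C_{2r}) < \frac12+\varepsilon$, where $C_{2r}$ is the cycle on $2r$ vertices and $K_{r,r}$ is the complete bipartite graph with $r$ vertices on each side.
   Context: Graphs are finite and simple. Let $H$ be a graph on vertex set $\{v_1,\dots,v_m\}$. An $H$-partite graph $G$ is a graph with a vertex partition $V=V_1\sqcup\dots\sqcup V_m$ into nonempty parts such that there are no edges inside any part, and no edges between $V_i$ and $V_j$ unless $v_iv_j\in E(H)$. For disjoint nonempty vertex sets $X,Y$, the edge density is $d(X,Y)=\frac{e(X,Y)}{|X||Y|}$, where $e(X,Y)$ is the number of edges between $X$ and $Y$. The $H$-partite density of $G$ is $d_H(G)=\min\{d(V_i,V_j): 1\le i<j\le m,\ v_iv_j\in E(H)\}$. A traversal of $G$ is a subgraph (on $m$ vertices) containing exactly one vertex from each part. For a graph $F$, $G$ contains an $F$-traversal if some traversal of $G$ contains $F$ as a subgraph (up to isomorphism). The critical density is $$\pi_H(F)=\sup\{\alpha\in[0,1]: \text{there exists an } H\text{ -partite graph } G \text{ with } d_H(G)\ge\alpha \text{ and no } F\text{ -traversal}\}.$$ -}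

module Defs where

open import Level using (0ℓ) renaming (suc to lsuc)
open import Data.Nat.Base as ℕ using (ℕ; NonZero; >-nonZero)
import Data.Nat.Properties as ℕₚ
open import Data.Nat.DivMod using (_%_)
open import Data.Integer.Base using (+_)
open import Data.Rational using (ℚ; 0ℚ; 1ℚ; _/_; _≤_; _<_)
import Data.Rational.Properties as ℚₚ
open import Data.Fin.Base using (Fin; toℕ)
import Data.Fin.Properties as Finₚ
open import Data.Fin.Subset using (Subset; Nonempty; ∣_∣; _∈_)
open import Data.Fin.Subset.Properties using (_∈?_; x∈p⇒∣p-x∣<∣p∣)
open import Data.List.Base using (List; length; map; filter; allFin; cartesianProduct)
open import Data.Product using (∃!; ∃-syntax; Σ-syntax; _×_; _,_)
open import Data.Sum using (_⊎_; inj₁; inj₂)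
import Data.Sum as Sum
open import Function.Definitions using (Injective)
open import Relation.Binary.Core using (Rel)
open import Relation.Binary.Bundles using (DecTotalOrder)
open import Relation.Binary.Definitions using (Decidable; Symmetric; Irreflexive)
open import Relation.Binary.PropositionalEquality using (_≡_; _≢_; refl)
open import Relation.Nullary using (¬_)
open import Relation.Nullary.Decidable using (_×-dec_; _⊎-dec_; ¬?)
open import Relation.Unary using (Pred)

import Data.List.Extrema (DecTotalOrder.totalOrder ℚₚ.≤-decTotalOrder) as Extrema

------------------------------------------------------------------------
-- Finite simple graphs

record Graph (n : ℕ) : Set₁ where
  field
    Adj    : Rel (Fin n) 0ℓ
    adj?   : Decidable Adj
    sym    : Symmetric Adj
    irrefl : Irreflexive _≡_ Adj

open Graph

-- The cycle 0, 1, …, n - 1.  The clause i ≢ j matters only for n = 1,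
-- where the cyclic successor would give a loop; for n = 2 the graph is a
-- single edge, and from n = 3 on it is the usual cycle.

next : ∀ {n} → Fin n → ℕ
next {n} i = ℕ.suc (toℕ i) % n
  where instance _ = Finₚ.nonZeroIndex i

C : ∀ n → Graph n
C n = record
  { Adj    = λ i j → i ≢ j × (next i ≡ toℕ j ⊎ next j ≡ toℕ i)
  ; adj?   = λ i j → ¬? (i Finₚ.≟ j)
                       ×-dec ((next i ℕₚ.≟ toℕ j) ⊎-dec (next j ℕₚ.≟ toℕ i))
  ; sym    = λ (i≢j , e) → (λ { refl → i≢j refl }) , Sum.swap e
  ; irrefl = λ i≡j (i≢j , _) → i≢j i≡j
  }

-- The sides are {0, …, r - 1} and {r, …, r + s - 1}.

K : ∀ r s → Graph (r ℕ.+ s)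
K r s = record
  { Adj    = λ i j → (toℕ i ℕ.< r × r ℕ.≤ toℕ j) ⊎ (toℕ j ℕ.< r × r ℕ.≤ toℕ i)
  ; adj?   = λ i j → ((toℕ i ℕₚ.<? r) ×-dec (r ℕₚ.≤? toℕ j))
                       ⊎-dec ((toℕ j ℕₚ.<? r) ×-dec (r ℕₚ.≤? toℕ i))
  ; sym    = Sum.swap
  ; irrefl = λ { refl (inj₁ (i<r , r≤i)) → ℕₚ.<⇒≱ i<r r≤i
               ; refl (inj₂ (i<r , r≤i)) → ℕₚ.<⇒≱ i<r r≤i }
  }

record Subgraph {n} (G : Graph n) : Set₁ where
  field
    vertices : Subset n
    SubAdj   : Rel (Fin n) 0ℓ
    subAdj?  : Decidable SubAdj
    sub-sym  : Symmetric SubAdj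
    ends     : ∀ {u v} → SubAdj u v → u ∈ vertices × v ∈ vertices
    sub⊆     : ∀ {u v} → SubAdj u v → Adj G u v

open Subgraph

-- Containment of a copy of F; the image need not be induced.

_Contains_ : ∀ {n k} {G : Graph n} → Subgraph G → Graph k → Set
_Contains_ {n} {k} T F =
  Σ[ f ∈ (Fin k → Fin n) ]
    Injective _≡_ _≡_ f
    × (∀ x → f x ∈ vertices T)
    × (∀ {x y} → Adj F x y → SubAdj T (f x) (f y))

------------------------------------------------------------------------
-- Edge density

-- For disjoint X and Y, each edge between them is one pair (x , y).

e : ∀ {n} → Graph n → Subset n → Subset n → ℕ
e {n} G X Y =
  length (filter (λ (x , y) → (x ∈? X) ×-dec (y ∈? Y) ×-dec adj? G x y)
                 (cartesianProduct (allFin n) (allFin n)))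

card-nonZero : ∀ {n} {X : Subset n} → Nonempty X → NonZero ∣ X ∣
card-nonZero (x , x∈X) =
  >-nonZero (ℕₚ.≤-<-trans ℕ.z≤n (x∈p⇒∣p-x∣<∣p∣ x∈X))

density : ∀ {n} → Graph n → (X Y : Subset n) → Nonempty X → Nonempty Y → ℚ
density G X Y X≠∅ Y≠∅ = + e G X Y / (∣ X ∣ ℕ.* ∣ Y ∣)
  where instance
    _ = ℕₚ.m*n≢0 ∣ X ∣ ∣ Y ∣ {{card-nonZero X≠∅}} {{card-nonZero Y≠∅}}

------------------------------------------------------------------------
-- H-partite graphs

record Partite {m} (H : Graph m) (n : ℕ) : Set₁ where
  field
    graph     : Graph n
    part      : Fin m → Subset n
    nonempty  : ∀ i → Nonempty (part i)
    partition : ∀ v → ∃! _≡_ (λ i → v ∈ part i)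
    -- With i = j this says that parts span no edges, as H has no loops.
    respects  : ∀ {i j u v} → u ∈ part i → v ∈ part j →
                Adj graph u v → Adj H i j

open Partite

edges : ∀ {m} → Graph m → List (Fin m × Fin m)
edges {m} H = filter (λ (i , j) → (i Finₚ.<? j) ×-dec adj? H i j)
                     (cartesianProduct (allFin m) (allFin m))

-- Since densities are at most 1, the default value 1ℚ does not affect the
-- minimum unless H has no edges.

d_H : ∀ {m n} {H : Graph m} → Partite H n → ℚ
d_H {m} {H = H} G = Extrema.min 1ℚ (map pairDensity (edges H))
  where
  pairDensity : Fin m × Fin m → ℚ
  pairDensity (i , j) =
    density (graph G) (part G i) (part G j) (nonempty G i) (nonempty G j)

IsTraversal : ∀ {m n} {H : Graph m} (G : Partite H n) → Subgraph (graph G) → Set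
IsTraversal G T = ∀ i → ∃! _≡_ (λ v → v ∈ part G i × v ∈ vertices T)

HasTraversal : ∀ {m n k} {H : Graph m} → Partite H n → Graph k → Set₁
HasTraversal G F = ∃[ T ] IsTraversal G T × T Contains F

------------------------------------------------------------------------
-- Critical density

-- A real number x is represented by its upper Dedekind cut, the set of
-- rationals q with x < q.  The supremum of S lies strictly below q exactly
-- when some rational upper bound of S does.

UpperReal : Set₂
UpperReal = Pred ℚ (lsuc 0ℓ)

_<ᵘ_ : UpperReal → ℚ → Set₁
x <ᵘ q = x q

sup : Pred ℚ (lsuc 0ℓ) → UpperReal
sup S q = ∃[ u ] (∀ {α} → S α → α ≤ u) × u < q

-- Rational α suffice: d_H takes only rational values in [0,1], so the
-- real α that qualify have the same supremum.

Avoidable : ∀ {m k} → Graph m → Graph k → Pred ℚ (lsuc 0ℓ)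
Avoidable H F α =
  0ℚ ≤ α × α ≤ 1ℚ ×
  (∃[ n ] Σ[ G ∈ Partite H n ] α ≤ d_H G × ¬ HasTraversal G F)

π : ∀ {m k} → Graph m → Graph k → UpperReal
π H F = sup (Avoidable H F)

{-# OPTIONS --safe #-}

-- Let every pair of opposite parts have density at least 1/2 + 1/q.  Relative to any list J of
-- opposite parts, each part has a vertex (a star) that sees on average a fraction 1/2 + 1/q of
-- the parts in J.  Two stars relative to J have a common neighbour in some part of J, so stars
-- chosen greedily, always relative to the parts still unused, form a path that exhausts one
-- side of the graph and leaves only boundedly many parts on the other side.
--
-- Stars of opposite sides can also be joined.  If x₀ sees more than half of many parts W_j and y₀
-- sees more than half of many parts V_i, but there is no path x₀ W V y₀ and no path
-- x₀ W V W V y₀, then in V_i the neighbours of y₀ avoid those vertices that are reached from x₀,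
-- likewise in W_j, and counting the possible edges gives an average density of about 1/2 at most.
--
-- Since r is large, pigeonhole yields beforehand a hub: boundedly many stars of one side
-- completely joined to vertices of boundedly many parts of the other side.  Starting from one
-- star of the hub, a greedy chain covers all V-parts outside the hub; a bridge and a chain of
-- stars of the other side, linked through parts of the hub, absorb the remaining W-parts; a
-- second bridge returns to another star of the hub.  The unused parts of the hub are covered by
-- zigzagging through the complete bipartite graph, which closes the cycle.

module Submission where

open import Defs
open import Data.Bool.Base using (Bool; true; false; not)
open import Data.Bool.Properties using (not-¬; not-involutive)
open import Data.Empty using (⊥; ⊥-elim)
open import Data.Fin.Base using (Fin; zero; suc; toℕ; _↑ˡ_; _↑ʳ_; splitAt)
import Data.Fin.Properties as Finₚ
open import Data.Fin.Subset using (Subset; ∣_∣) renaming (_∈_ to _∈ˢ_)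
open import Data.Fin.Subset.Properties using (_∈?_; drop-there; ∣p∣≤n)
open import Data.Integer.Base as ℤ using (+[1+_]; +<+)
import Data.Integer.Properties as ℤₚ
open import Data.List.Base
  using (List; []; _∷_; [_]; _++_; map; length; concat; replicate; filter; take; drop; lookup; tabulate; allFin; cartesianProduct)
import Data.List.Extrema
open import Data.List.Membership.Propositional using (_∈_; find; lose)
open import Data.List.Membership.Propositional.Properties
  using (∈-∃++; ∈-filter⁻; ∈-filter⁺; ∈-++⁺ˡ; ∈-++⁺ʳ; ∈-++⁻; ∈-map⁺; ∈-allFin; ∈-cartesianProduct⁺; ∈-lookup)
open import Data.List.Properties
  using (map-++; map-tabulate; length-++; length-map; length-tabulate; length-take; take++drop≡id; ++-identityʳ; ++-assoc)
open import Data.List.Relation.Binary.Permutation.Propositional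
  using (_↭_; prep; ↭-refl; ↭-sym; ↭-trans; ↭-reflexive; ↭⇒↭ₛ)
open import Data.List.Relation.Binary.Permutation.Propositional.Properties
  using (map⁺; shift; shifts; ++⁺; ++⁺ˡ; ++⁺ʳ; ∈-resp-↭; All-resp-↭; ↭-length; ++-commutativeMonoid)
open import Data.List.Relation.Binary.Permutation.Setoid.Properties using (Unique-resp-↭)
open import Data.List.Relation.Unary.All as All using (All; []; _∷_; all?)
open import Data.List.Relation.Unary.All.Properties using (++⁻ˡ; ++⁻ʳ) renaming (map⁺ to All-map⁺)
open import Data.List.Relation.Unary.AllPairs using ([]; _∷_)
open import Data.List.Relation.Unary.Any using (Any; here; there; any?; index)
open import Data.List.Relation.Unary.Any.Properties using (lookup-index)
open import Data.List.Relation.Unary.Unique.Propositional using (Unique)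
import Data.List.Relation.Unary.Unique.Propositional.Properties as Uniqueₚ
open import Data.Nat.Base as ℕ using (ℕ; zero; suc; _+_; _*_; _^_; _%_; _!; _≤_; _<_; z≤n; s≤s)
open import Data.Nat.Divisibility using (_∣_; quotient; m≤n⇒m!∣n!; m∣m*n; ∣-trans)
open import Data.Nat.DivMod using (m<n⇒m%n≡m; n%n≡0)
open import Data.Nat.ListAction using (sum)
open import Data.Nat.ListAction.Properties using (sum-↭; sum-++)
open import Data.Nat.Properties
open import Data.Nat.Tactic.RingSolver using (solve-∀)
open import Data.Product using (∃-syntax; _×_; _,_; proj₁; proj₂)
open import Data.Rational as ℚ using (ℚ; 0ℚ; 1ℚ; ½; mkℚ)
import Data.Rational.Properties as ℚₚ
import Data.Rational.Unnormalised.Base as ℚᵘ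
import Data.Rational.Unnormalised.Properties as ℚᵘₚ
open import Data.Sum using (_⊎_; inj₁; inj₂; [_,_]′)
open import Data.Vec.Base as Vec using ([]; _∷_)
open import Data.Vec.Properties using (lookup∘tabulate; lookup⇒[]=; []=⇒lookup)
open import Function.Definitions using (Injective)
open import Relation.Binary.Bundles using (DecTotalOrder)
open import Relation.Binary.Definitions using (Decidable; DecidableEquality; Symmetric)
open import Relation.Binary.PropositionalEquality hiding ([_])
open import Relation.Nullary using (¬_; Dec; yes; no; does)
open import Relation.Nullary.Decidable using (¬?; _×-dec_; _⊎-dec_; dec-true; dec-false; decidable-stable)
open import Relation.Unary using () renaming (Decidable to Decidable₁)
import Algebra.Solver.CommutativeMonoid as CMSolver

module Extremaℚ = Data.List.Extrema (DecTotalOrder.totalOrder ℚₚ.≤-decTotalOrder)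

private variable
  A B : Set

-- Finite sums and counting

∑ : List A → (A → ℕ) → ℕ
∑ xs f = sum (map f xs)

infix 8 ∑-syntax
∑-syntax : List A → (A → ℕ) → ℕ
∑-syntax = ∑
syntax ∑-syntax xs (λ x → e) = ∑[ x ∈ xs ] e

∑-mono : ∀ (xs : List A) {f g : A → ℕ} → (∀ {x} → x ∈ xs → f x ≤ g x) → ∑ xs f ≤ ∑ xs g
∑-mono []       h = z≤n
∑-mono (x ∷ xs) h = +-mono-≤ (h (here refl)) (∑-mono xs (λ m → h (there m)))

∑-cong : ∀ (xs : List A) {f g : A → ℕ} → (∀ x → f x ≡ g x) → ∑ xs f ≡ ∑ xs g
∑-cong []       h = refl
∑-cong (x ∷ xs) h = cong₂ _+_ (h x) (∑-cong xs h)

∑-const : ∀ (xs : List A) c → ∑[ _ ∈ xs ] c ≡ length xs * c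
∑-const []       c = refl
∑-const (x ∷ xs) c = cong (c +_) (∑-const xs c)

∑-+ : ∀ (xs : List A) (f g : A → ℕ) → ∑[ x ∈ xs ] (f x + g x) ≡ ∑ xs f + ∑ xs g
∑-+ []       f g = refl
∑-+ (x ∷ xs) f g rewrite ∑-+ xs f g = lemma (f x) (g x) (∑ xs f) (∑ xs g)
  where
  lemma : ∀ a b c d → a + b + (c + d) ≡ a + c + (b + d)
  lemma = solve-∀

∑-*ˡ : ∀ c (xs : List A) (f : A → ℕ) → ∑[ x ∈ xs ] (c * f x) ≡ c * ∑ xs f
∑-*ˡ c []       f = sym (*-zeroʳ c)
∑-*ˡ c (x ∷ xs) f = trans (cong (c * f x +_) (∑-*ˡ c xs f)) (sym (*-distribˡ-+ c _ _))

∑-≤ : ∀ (xs : List A) {f : A → ℕ} {c} → (∀ {x} → x ∈ xs → f x ≤ c) → ∑ xs f ≤ length xs * c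
∑-≤ xs {f} {c} h = subst (∑ xs f ≤_) (∑-const xs c) (∑-mono xs h)

∑-≥ : ∀ (xs : List A) {f : A → ℕ} {c} → (∀ {x} → x ∈ xs → c ≤ f x) → length xs * c ≤ ∑ xs f
∑-≥ xs {f} {c} h = subst (_≤ ∑ xs f) (∑-const xs c) (∑-mono xs h)

∑-swap : ∀ (xs : List A) (ys : List B) (f : A → B → ℕ) →
         ∑[ x ∈ xs ] ∑[ y ∈ ys ] f x y ≡ ∑[ y ∈ ys ] ∑[ x ∈ xs ] f x y
∑-swap []       ys f = sym (trans (∑-const ys 0) (*-zeroʳ (length ys)))
∑-swap (x ∷ xs) ys f = trans (cong (∑ ys (f x) +_) (∑-swap xs ys f)) (sym (∑-+ ys (f x) _))

∑-↭ : ∀ {xs ys : List A} (f : A → ℕ) → xs ↭ ys → ∑ xs f ≡ ∑ ys f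
∑-↭ f p = sum-↭ (map⁺ f p)

∑-++ : ∀ (xs ys : List A) (f : A → ℕ) → ∑ (xs ++ ys) f ≡ ∑ xs f + ∑ ys f
∑-++ xs ys f = trans (cong sum (map-++ f xs ys)) (sum-++ (map f xs) (map f ys))

∑-exceeds : ∀ (xs : List A) {f : A → ℕ} {c} → length xs * c < ∑ xs f → ∃[ x ] x ∈ xs × c < f x
∑-exceeds (x ∷ xs) {f} {c} p with c <? f x
... | yes c<f = x , here refl , c<f
... | no  c≮f with ∑-exceeds xs (+-cancelˡ-< c _ _ (<-≤-trans p (+-monoˡ-≤ _ (≮⇒≥ c≮f))))
...   | y , y∈ , q = y , there y∈ , q

∑-average : ∀ (xs : List A) {f : A → ℕ} {c} → 0 < length xs → length xs * c ≤ ∑ xs f →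
            ∃[ x ] x ∈ xs × c ≤ f x
∑-average xs {c = zero} l p with xs
... | x ∷ _ = x , here refl , z≤n
∑-average xs {c = suc c} l p = ∑-exceeds xs (<-≤-trans (*-monoʳ-< (length xs) {{ℕ.>-nonZero l}} ≤-refl) p)

-- Indicators, counting and selection of sublists

𝟙 : Dec A → ℕ
𝟙 (yes _) = 1
𝟙 (no  _) = 0

𝟙≤1 : (d : Dec A) → 𝟙 d ≤ 1
𝟙≤1 (yes _) = ≤-refl
𝟙≤1 (no  _) = z≤n

𝟙-yes : (d : Dec A) → A → 𝟙 d ≡ 1
𝟙-yes (yes _) _ = refl
𝟙-yes (no ¬a) a = ⊥-elim (¬a a)

𝟙-no : (d : Dec A) → ¬ A → 𝟙 d ≡ 0
𝟙-no (yes a) ¬a = ⊥-elim (¬a a)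
𝟙-no (no _)  _  = refl

𝟙-cong : (d : Dec A) (e : Dec B) → (A → B) → (B → A) → 𝟙 d ≡ 𝟙 e
𝟙-cong (yes a) e f g = sym (𝟙-yes e (f a))
𝟙-cong (no ¬a) e f g = sym (𝟙-no e (λ b → ¬a (g b)))

count : {P : A → Set} → Decidable₁ P → List A → ℕ
count P? xs = ∑[ x ∈ xs ] 𝟙 (P? x)

count-≤ : {P : A → Set} (P? : Decidable₁ P) (xs : List A) → count P? xs ≤ length xs
count-≤ P? xs = subst (count P? xs ≤_) (*-identityʳ _) (∑-≤ xs (λ _ → 𝟙≤1 (P? _)))

split : {P : A → Set} (P? : Decidable₁ P) (xs : List A) →
        ∃[ ys ] ∃[ zs ] xs ↭ ys ++ zs × All P ys × All (λ x → ¬ P x) zs × length ys ≡ count P? xs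
split P? [] = [] , [] , ↭-refl , [] , [] , refl
split P? (x ∷ xs) with split P? xs | P? x
... | ys , zs , p , ay , az , l | yes px = x ∷ ys , zs , prep x p , px ∷ ay , az , cong suc l
... | ys , zs , p , ay , az , l | no ¬px =
  ys , x ∷ zs , ↭-trans (prep x p) (↭-sym (shift x ys zs)) , ay , ¬px ∷ az , l

extract : ∀ {x : A} {xs} → x ∈ xs → ∃[ ys ] xs ↭ x ∷ ys
extract {x = x} x∈ with ∈-∃++ x∈
... | ys , zs , refl = ys ++ zs , shift x ys zs

extract₂ : ∀ {x y : A} {xs} → x ∈ xs → y ∈ xs → x ≢ y → ∃[ ys ] xs ↭ x ∷ y ∷ ys
extract₂ x∈ y∈ x≢y with extract x∈
... | ys , p with ∈-resp-↭ p y∈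
...   | here refl = ⊥-elim (x≢y refl)
...   | there y∈′ with extract y∈′
...     | zs , p′ = zs , ↭-trans p (prep _ p′)

-- Without repetitions, at most one of two entries satisfying `P` can be `x`. In the bridge argument
-- this supplies a second part distinct from the one already on the path.
element-other-than : {P : A → Set} (P? : Decidable₁ P) {xs : List A} → Unique xs → 2 ≤ count P? xs →
                     ∀ x → (∀ y → Dec (x ≡ y)) → Any (λ y → x ≢ y × P y) xs
element-other-than {A} {P} P? {y ∷ ys} (y∉ ∷ u) c x x≟ with P? y
... | no _ = there (element-other-than P? u c x x≟)
... | yes py with x≟ y
...   | no x≢y = here (x≢y , py)
...   | yes refl = there (one y∉ (ℕ.s≤s⁻¹ c))
  where
  one : ∀ {zs} → All (x ≢_) zs → 1 ≤ count P? zs → Any (λ z → x ≢ z × P z) zs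
  one {z ∷ zs} (n ∷ ns) c with P? z
  ... | yes pz = here (n , pz)
  ... | no _   = there (one ns c)

-- If two entries satisfy `P`, every term vanishes; otherwise the sum is bounded by the count
-- itself. It bounds the exceptional parts in the bridge argument.
lonely≤1 : {P : A → Set} (P? : Decidable₁ P) (xs : List A) →
           ∑[ x ∈ xs ] 𝟙 (P? x ×-dec ¬? (2 ≤? count P? xs)) ≤ 1
lonely≤1 P? xs with 2 ≤? count P? xs
... | yes c = ≤-trans (∑-≤ xs {c = 0} (λ {x} _ → none (P? x))) (≤-trans (≤-reflexive (*-zeroʳ (length xs))) z≤n)
  where
  none : ∀ {B : Set} (d : Dec B) → 𝟙 (d ×-dec ¬? (yes c)) ≤ 0
  none (yes _) = z≤n
  none (no _)  = z≤n
... | no ¬c = ≤-trans (∑-mono xs (λ {x} _ → only (P? x))) (ℕ.s≤s⁻¹ (≰⇒> ¬c))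
  where
  only : ∀ {B : Set} (d : Dec B) → 𝟙 (d ×-dec ¬? (no ¬c)) ≤ 𝟙 d
  only (yes _) = ≤-refl
  only (no _)  = z≤n

count+count¬ : {P : A → Set} (P? : Decidable₁ P) (xs : List A) →
               count P? xs + count (λ x → ¬? (P? x)) xs ≡ length xs
count+count¬ P? [] = refl
count+count¬ P? (x ∷ xs) with P? x
... | yes _ = cong suc (count+count¬ P? xs)
... | no  _ = trans (+-suc _ _) (cong suc (count+count¬ P? xs))

𝟙-mono : (d : Dec A) (e : Dec B) → (A → B) → 𝟙 d ≤ 𝟙 e
𝟙-mono (yes a) e f = ≤-reflexive (sym (𝟙-yes e (f a)))
𝟙-mono (no _)  e f = z≤n

∑-*ʳ : ∀ (xs : List A) (f : A → ℕ) c → ∑[ x ∈ xs ] (f x * c) ≡ ∑ xs f * c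
∑-*ʳ []       f c = refl
∑-*ʳ (x ∷ xs) f c = trans (cong (f x * c +_) (∑-*ʳ xs f c)) (sym (*-distribʳ-+ c (f x) _))

-- Chebyshev's sum inequality for two oppositely ordered pairs.
opposite-sorted : ∀ {a b c d} → c ≤ a → b ≤ d → 2 * (a * b + c * d) ≤ (a + c) * (b + d)
opposite-sorted {a} {b} {c} {d} c≤a b≤d
  with k , refl ← m≤n⇒∃[o]m+o≡n c≤a | l , refl ← m≤n⇒∃[o]m+o≡n b≤d =
  subst (2 * ((c + k) * b + c * (b + l)) ≤_) (lemma b c k l) (m≤m+n _ (k * l))
  where
  lemma : ∀ b c k l → 2 * ((c + k) * b + c * (b + l)) + k * l ≡ (c + k + c) * (b + (b + l))
  lemma = solve-∀

any-of : {P : A → Set} (P? : Decidable₁ P) {xs : List A} → 1 ≤ count P? xs → Any P xs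
any-of P? {x ∷ xs} c with P? x
... | yes px = here px
... | no _   = there (any-of P? c)

length-filter≡count : {P : A → Set} (P? : Decidable₁ P) (xs : List A) → length (filter P? xs) ≡ count P? xs
length-filter≡count P? [] = refl
length-filter≡count P? (x ∷ xs) with P? x
... | yes _ = cong suc (length-filter≡count P? xs)
... | no  _ = length-filter≡count P? xs

Unique-↭ : ∀ {xs ys : List A} → xs ↭ ys → Unique xs → Unique ys
Unique-↭ p = Unique-resp-↭ (setoid _) (↭⇒↭ₛ p)

-- Entries below `M` contribute at most `M` and the `c` others at most `2 * M`, so the sum is at
-- most `(length xs + c) * M`. On the other hand the average is at least `(1 + 2/q) * M` up to the
-- error `s`, which forces `2 * length xs ≤ s + q * c`.
many-heavy : ∀ (xs : List A) (f : A → ℕ) {q s k M} → 0 < M → (∀ x → f x ≤ 2 * M) →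
             (q + 2) * M * length xs ≤ q * ∑ xs f + s * M → s + q * k < 2 * length xs →
             k < count (λ x → M ≤? f x) xs
many-heavy xs f {q} {s} {k} {M} 0<M f≤2M h l = *-cancelˡ-< q _ _ (+-cancelˡ-< s _ _ (<-≤-trans l (*-cancelˡ-≤ M
  (+-cancelˡ-≤ (q * (length xs * M)) _ _ (begin
    q * (length xs * M) + M * (2 * length xs)  ≡⟨ lemma₁ q (length xs) M ⟩
    (q + 2) * M * length xs                    ≤⟨ h ⟩
    q * ∑ xs f + s * M                         ≤⟨ +-monoˡ-≤ (s * M) (*-monoʳ-≤ q ∑f≤) ⟩
    q * (length xs * M + c * M) + s * M        ≡⟨ lemma₂ q (length xs) M c s ⟩
    q * (length xs * M) + M * (s + q * c)      ∎)))))
  where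
  open ≤-Reasoning
  instance _ = ℕ.>-nonZero 0<M
  c = count (λ x → M ≤? f x) xs
  bound : ∀ x → f x ≤ M + 𝟙 (M ≤? f x) * M
  bound x with M ≤? f x
  ... | yes _ = f≤2M x
  ... | no  p = ≤-trans (<⇒≤ (≰⇒> p)) (m≤m+n M _)
  ∑f≤ : ∑ xs f ≤ length xs * M + c * M
  ∑f≤ = ≤-trans (∑-mono xs (λ {x} _ → bound x))
    (≤-reflexive (trans (∑-+ xs _ _) (cong₂ _+_ (∑-const xs M) (∑-*ʳ xs _ M))))
  lemma₁ : ∀ q l m → q * (l * m) + m * (2 * l) ≡ (q + 2) * m * l
  lemma₁ = solve-∀
  lemma₂ : ∀ q l m c s → q * (l * m + c * m) + s * m ≡ q * (l * m) + m * (s + q * c)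
  lemma₂ = solve-∀

split-length : ∀ n {xs : List A} → n ≤ length xs → ∃[ ys ] ∃[ zs ] xs ≡ ys ++ zs × length ys ≡ n
split-length n {xs} n≤ = take n xs , drop n xs , sym (take++drop≡id n xs) , trans (length-take n xs) (m≤n⇒m⊓n≡m n≤)

-- Halving once for each element of xs.
homogeneous : {R : A → B → Set} (R? : ∀ x y → Dec (R x y)) (xs : List A) (ys : List B) {b : ℕ} →
              b * 2 ^ length xs ≤ length ys →
              ∃[ zs ] ∃[ ws ] ys ↭ zs ++ ws × b ≤ length zs ×
              All (λ x → All (R x) zs ⊎ All (λ y → ¬ R x y) zs) xs
homogeneous R? [] ys {b} h = ys , [] , ↭-reflexive (sym (++-identityʳ ys)) , subst (_≤ length ys) (*-identityʳ b) h , []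
homogeneous {R = R} R? (x ∷ xs) ys {b} h with split (R? x) ys
... | ps , ns , p , yes-ps , no-ns , _ with b * 2 ^ length xs ≤? length ps
...   | yes l = let zs , ws , p′ , b≤ , hom = homogeneous R? xs ps l
                in  zs , ws ++ ns , ↭-trans p (↭-trans (++⁺ʳ ns p′) (↭-reflexive (++-assoc zs ws ns))) , b≤ ,
                    inj₁ (++⁻ˡ zs (All-resp-↭ p′ yes-ps)) ∷ hom
...   | no l =  let zs , ws , p′ , b≤ , hom = homogeneous R? xs ns (+-cancelˡ-≤ (b * 2 ^ length xs) _ _ rest)
                in  zs , ps ++ ws , ↭-trans p (↭-trans (++⁺ˡ ps p′) (shifts ps zs)) , b≤ ,
                    inj₂ (++⁻ˡ zs (All-resp-↭ p′ no-ns)) ∷ hom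
  where
  open ≤-Reasoning
  lemma : ∀ b k → b * (2 * k) ≡ b * k + b * k
  lemma = solve-∀
  rest : b * 2 ^ length xs + b * 2 ^ length xs ≤ b * 2 ^ length xs + length ns
  rest = begin
    b * 2 ^ length xs + b * 2 ^ length xs  ≡⟨ lemma b (2 ^ length xs) ⟨
    b * 2 ^ length (x ∷ xs)                ≤⟨ h ⟩
    length ys                              ≡⟨ trans (↭-length p) (length-++ ps) ⟩
    length ps + length ns                  ≤⟨ +-monoˡ-≤ (length ns) (<⇒≤ (≰⇒> l)) ⟩
    b * 2 ^ length xs + length ns          ∎

-- Finite choice. Entries stay paired with their witnesses because a part and the vertex chosen in
-- it are needed together later.
choose : {R : A → B → Set} (xs : List A) → All (λ x → ∃[ y ] R x y) xs →
         ∃[ ys ] map proj₁ ys ≡ xs × All (λ (x , y) → R x y) ys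
choose [] [] = [] , refl , []
choose (x ∷ xs) ((y , r) ∷ rs) = let ys , e , ok = choose xs rs in (x , y) ∷ ys , cong (x ∷_) e , r ∷ ok

-- A neighbour of the single vertex `y` cannot be of the kind that is joined to nothing in `ys`, so
-- by homogeneity it is joined to everything.
complete-count : {R : A → B → Set} (R? : ∀ x y → Dec (R x y)) (xs : List A) {ys : List B} {y : B} → y ∈ ys →
                 All (λ x → All (R x) ys ⊎ All (λ y → ¬ R x y) ys) xs →
                 count (λ x → R? x y) xs ≤ count (λ x → all? (R? x) ys) xs
complete-count R? xs {ys} {y} y∈ hom = ∑-mono xs λ {x} x∈ → 𝟙-mono (R? x y) (all? (R? x) ys) λ r →
  [ (λ c → c) , (λ none → ⊥-elim (All.lookup none y∈ r)) ]′ (All.lookup hom x∈)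

inhabited : ∀ (xs : List A) → 0 < length xs → ∃[ x ] x ∈ xs
inhabited (x ∷ _) _ = x , here refl

Unique-++⁻ʳ : ∀ (xs : List A) {ys} → Unique (xs ++ ys) → Unique ys
Unique-++⁻ʳ []       u       = u
Unique-++⁻ʳ (_ ∷ xs) (_ ∷ u) = Unique-++⁻ʳ xs u

Unique-++⁻ˡ : ∀ (xs : List A) {ys} → Unique (xs ++ ys) → Unique xs
Unique-++⁻ˡ []       _        = []
Unique-++⁻ˡ (_ ∷ xs) (x∉ ∷ u) = ++⁻ˡ xs x∉ ∷ Unique-++⁻ˡ xs u

-- Sizes

-- The hub has hubV parts on one side and hubW on the other, and the greedy chain leaves about
-- reserve parts of the second side over.  Here 1/2 + 1/q is the density.
reserve hubW hubV margin threshold : ℕ → ℕ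
reserve q = q * (2 * q) + 4 * q + 2
hubW q = 3 * q + q * (reserve q + 1) + 1
hubV q = suc (suc (hubW q + reserve q + 1))
margin q = 2 * q * (hubW q + 3) + q * (2 * q)
threshold q = (hubV q + hubV q) + (q * (hubW q * 2 ^ (hubV q + hubV q)) + suc (margin q))

-- Room for the second bridge: its starting star has error `2 * q` from the chain and `2 * q * 1`
-- from the removal of one part, and `q * (2 * q)` ensures more than `2 * q` heavy parts.
star-size : ∀ q {w} → reserve q ≤ suc w → 2 * q + 2 * q * 1 + q * (2 * q) < 2 * w
star-size q {w} h = +-cancelˡ-≤ 2 _ _ (begin
  2 + suc (2 * q + 2 * q * 1 + q * (2 * q))                             ≤⟨ m≤m+n _ (q * (2 * q) + 4 * q + 1) ⟩
  2 + suc (2 * q + 2 * q * 1 + q * (2 * q)) + (q * (2 * q) + 4 * q + 1) ≡⟨ lemma q ⟩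
  2 * reserve q  ≤⟨ *-monoʳ-≤ 2 h ⟩
  2 * suc w      ≡⟨ *-distribˡ-+ 2 1 w ⟩
  2 + 2 * w      ∎)
  where
  open ≤-Reasoning
  lemma : ∀ q → 2 + suc (2 * q + 2 * q * 1 + q * (2 * q)) + (q * (2 * q) + 4 * q + 1) ≡
                2 * (q * (2 * q) + 4 * q + 2)
  lemma = solve-∀

reserve-size : ∀ q {n} → reserve q ≤ n → q * (2 * q) < 2 * n
reserve-size q {n} h = begin-strict
  q * (2 * q)          ≤⟨ m≤m+n _ (4 * q) ⟩
  q * (2 * q) + 4 * q  <⟨ m<m+n _ (s≤s z≤n) ⟩
  reserve q            ≤⟨ h ⟩
  n                    ≤⟨ m≤m+n n _ ⟩
  2 * n                ∎
  where open ≤-Reasoning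

-- Room for the chain that absorbs the last `w` parts: the two ends have errors `4 * q` and `8 * q`,
-- and each part passed costs `2 * q + 4`. The value of `hubW q` covers this up to
-- `w = reserve q + 1`.
chain-size : ∀ q {w n} → w ≤ reserve q + 1 → hubW q + w ≤ n → 4 * q + 8 * q + (2 * q + 4) * w < 4 * n
chain-size q {w} {n} w≤ h = begin-strict
  4 * q + 8 * q + (2 * q + 4) * w                           ≡⟨ lemma₁ q w ⟩
  12 * q + 2 * q * w + 4 * w                                ≤⟨ +-monoˡ-≤ (4 * w) (+-monoʳ-≤ (12 * q) (*-monoʳ-≤ (2 * q) w≤)) ⟩
  12 * q + 2 * q * (k + 1) + 4 * w                          <⟨ m<m+n _ {2 * q * (k + 1) + 4} (≤-trans (s≤s z≤n) (m≤n+m 4 _)) ⟩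
  12 * q + 2 * q * (k + 1) + 4 * w + (2 * q * (k + 1) + 4)  ≡⟨ lemma₂ q k w ⟩
  4 * (hubW q + w)                                          ≤⟨ *-monoʳ-≤ 4 h ⟩
  4 * n                                                     ∎
  where
  open ≤-Reasoning
  k = reserve q
  lemma₁ : ∀ q w → 4 * q + 8 * q + (2 * q + 4) * w ≡ 12 * q + 2 * q * w + 4 * w
  lemma₁ = solve-∀
  lemma₂ : ∀ q k w → 12 * q + 2 * q * (k + 1) + 4 * w + (2 * q * (k + 1) + 4) ≡
                     4 * (3 * q + q * (k + 1) + 1 + w)
  lemma₂ = solve-∀

slack-size : ∀ q {u v} → u ≤ 2 → v ≡ u → 2 * q * v ≤ 4 * q
slack-size q {u} u≤ refl = ≤-trans (*-monoʳ-≤ (2 * q) u≤) (≤-reflexive (lemma q))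
  where
  lemma : ∀ q → 2 * q * 2 ≡ 4 * q
  lemma = solve-∀

length-↭-++ : ∀ {xs zs : List A} ys → xs ↭ ys ++ zs → length xs ≡ length ys + length zs
length-↭-++ ys p = trans (↭-length p) (length-++ ys)

remaining-size : ∀ {m n k l u v w} → m + n ≤ k → n ≡ u + w → k ≡ v + l → v ≡ u → m + w ≤ l
remaining-size {m} {u = u} {w = w} h refl refl refl =
  +-cancelˡ-≤ u _ _ (≤-trans (≤-reflexive (trans (sym (+-assoc u m w)) (trans (cong (_+ w) (+-comm u m)) (+-assoc m u w)))) h)

route-size : ∀ {w v k} → suc w ≡ v + (k + 3) → w ≡ v + (k + 2)
route-size {v = v} {k} e = suc-injective (trans e (lemma v k))
  where
  lemma : ∀ v k → v + (k + 3) ≡ suc (v + (k + 2))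
  lemma = solve-∀

left-size : ∀ {w v k u wᵤ w₂ x y} → w ≡ v + (k + 2) → w ≡ wᵤ + w₂ → w₂ ≡ x + y → x ≡ v → wᵤ ≡ u →
            u + y ≡ k + 2
left-size {v = v} {k} {u} {y = y} e refl refl refl refl = +-cancelˡ-≡ v _ _ (trans (lemma v u y) e)
  where
  lemma : ∀ v u y → v + (u + y) ≡ u + (v + y)
  lemma = solve-∀

hub-size : ∀ q {n} → n ≡ hubW q + reserve q + 1 → reserve q ≤ n
hub-size q refl = ≤-trans (m≤n+m (reserve q) (hubW q)) (m≤m+n _ 1)

margin-size : ∀ q {v w} → margin q < v → w ≡ v + (reserve q + 2) →
              2 * q * hubW q + 2 * q * 1 + q * (2 * q) < 2 * w
margin-size q {v} big refl = begin-strict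
  2 * q * hubW q + 2 * q * 1 + q * (2 * q)  ≡⟨ cong (_+ q * (2 * q)) (*-distribˡ-+ (2 * q) (hubW q) 1) ⟨
  2 * q * (hubW q + 1) + q * (2 * q)        ≤⟨ +-monoˡ-≤ (q * (2 * q)) (*-monoʳ-≤ (2 * q) (+-monoʳ-≤ (hubW q) {1} {3} (s≤s z≤n))) ⟩
  margin q                                  <⟨ big ⟩
  v                                         ≤⟨ ≤-trans (m≤m+n v (reserve q + 2)) (m≤m+n _ _) ⟩
  2 * (v + (reserve q + 2))                 ∎
  where open ≤-Reasoning

-- A bridge takes at most two parts from W, and these are paid for by the 2 in the surplus
-- `reserve q + 2`.
room : ∀ q {v w wᵤ w₂ u} → w ≡ v + (reserve q + 2) → w ≡ wᵤ + w₂ → wᵤ ≡ u → u ≤ 2 → v + reserve q ≤ w₂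
room q {v} {w₂ = w₂} {u} e refl refl u≤ = +-cancelˡ-≤ u _ _ (begin
  u + (v + reserve q)  ≤⟨ +-monoˡ-≤ _ u≤ ⟩
  2 + (v + reserve q)  ≡⟨ lemma v (reserve q) ⟩
  v + (reserve q + 2)  ≡⟨ e ⟨
  u + w₂               ∎)
  where
  open ≤-Reasoning
  lemma : ∀ v k → 2 + (v + k) ≡ v + (k + 2)
  lemma = solve-∀

margin-size′ : ∀ q {v w wᵤ w₂ u} → margin q < v → w ≡ v + (reserve q + 2) → w ≡ wᵤ + w₂ → wᵤ ≡ u → u ≤ 2 →
               2 * q * hubW q + 2 * q * 1 + 2 * q * wᵤ < 4 * w₂
margin-size′ q {v} {w₂ = w₂} {u} big e e′ refl u≤ = begin-strict
  2 * q * hubW q + 2 * q * 1 + 2 * q * u  ≤⟨ +-monoʳ-≤ (2 * q * hubW q + 2 * q * 1) (*-monoʳ-≤ (2 * q) u≤) ⟩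
  2 * q * hubW q + 2 * q * 1 + 2 * q * 2  ≡⟨ lemma q (hubW q) ⟩
  2 * q * (hubW q + 3)                    ≤⟨ m≤m+n _ _ ⟩
  margin q                                <⟨ big ⟩
  v                                       ≤⟨ m≤m+n v (reserve q) ⟩
  v + reserve q                           ≤⟨ room q {v} e e′ refl u≤ ⟩
  w₂                                      ≤⟨ m≤m+n w₂ _ ⟩
  4 * w₂                                  ∎
  where
  open ≤-Reasoning
  lemma : ∀ q h → 2 * q * h + 2 * q * 1 + 2 * q * 2 ≡ 2 * q * (h + 3)
  lemma = solve-∀

chain-room : ∀ q {v w wᵤ w₂ u} → w ≡ suc v + (reserve q + 2) → w ≡ wᵤ + w₂ → wᵤ ≡ u → u ≤ 2 → v + suc q ≤ w₂
chain-room q {v} e e′ eᵤ u≤ = ≤-trans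
  (≤-trans (≤-reflexive (+-suc v q)) (+-monoʳ-≤ (suc v) (≤-trans (m≤m+n q _) (≤-trans (m≤n+m (4 * q) (q * (2 * q))) (m≤m+n _ 2)))))
  (room q {suc v} e e′ eᵤ u≤)

not-empty : ∀ q {v w wᵤ w₂ u x} → w ≡ v + (reserve q + 2) → w ≡ wᵤ + w₂ → w₂ ≡ x + 0 → x ≡ v → wᵤ ≡ u → u ≤ 2 → ⊥
not-empty q e e′ e″ ex eᵤ u≤ with trans (sym (+-identityʳ _)) (left-size e e′ e″ ex eᵤ)
... | refl = <⇒≱ (≤-trans (m<n+m 2 (≤-trans (s≤s z≤n) (m≤n+m 2 _))) ≤-refl) u≤

reserve-left : ∀ q {u w} → u + suc w ≡ reserve q + 2 → u ≤ 2 → reserve q ≤ suc w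
reserve-left q {u} {w} e u≤ = +-cancelˡ-≤ 2 _ _ (begin
  2 + reserve q  ≡⟨ +-comm 2 (reserve q) ⟩
  reserve q + 2  ≡⟨ e ⟨
  u + suc w      ≤⟨ +-monoˡ-≤ (suc w) u≤ ⟩
  2 + suc w      ∎)
  where open ≤-Reasoning

reserve-right : ∀ q {u w} → u + suc w ≡ reserve q + 2 → w ≤ reserve q + 1
reserve-right q {u} {w} e = ℕ.s≤s⁻¹ (≤-trans (m≤n+m (suc w) u) (≤-reflexive (trans e (+-suc (reserve q) 1))))

hub-left : ∀ q {u w n m} → u + suc w ≡ reserve q + 2 → n ≡ hubW q + reserve q + 1 → n ≡ u + m → hubW q + w ≤ m
hub-left q {u} {w} {m = m} e e′ refl = +-cancelˡ-≤ (suc u) _ _ (≤-reflexive (begin-equality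
  suc u + (hubW q + w)          ≡⟨ lemma₁ u (hubW q) w ⟩
  hubW q + (u + suc w)          ≡⟨ cong (hubW q +_) e ⟩
  hubW q + (reserve q + 2)      ≡⟨ lemma₂ (hubW q) (reserve q) ⟩
  suc (hubW q + reserve q + 1)  ≡⟨ cong suc e′ ⟨
  suc u + m                     ∎))
  where
  open ≤-Reasoning
  lemma₁ : ∀ u h w → suc u + (h + w) ≡ h + (u + suc w)
  lemma₁ = solve-∀
  lemma₂ : ∀ h k → h + (k + 2) ≡ suc (h + k + 1)
  lemma₂ = solve-∀

hub-left′ : ∀ q {u n m} → n ≡ hubW q + reserve q + 1 → n ≡ u + m → u ≤ 2 → reserve q ≤ m
hub-left′ q {u} {m = m} e refl u≤ = +-cancelˡ-≤ 2 _ _ (begin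
  2 + reserve q          ≡⟨ +-comm 2 (reserve q) ⟩
  reserve q + 2          ≤⟨ m≤n+m (reserve q + 2) h ⟩
  h + (reserve q + 2)    ≡⟨ lemma h (reserve q) ⟩
  h + 1 + reserve q + 1  ≡⟨ e ⟨
  u + m                  ≤⟨ +-monoˡ-≤ m u≤ ⟩
  2 + m                  ∎)
  where
  open ≤-Reasoning
  h = 3 * q + q * (reserve q + 1)
  lemma : ∀ h k → h + (k + 2) ≡ h + 1 + k + 1
  lemma = solve-∀

hub-fits : ∀ q {n} → threshold q ≤ n → hubV q + hubV q ≤ n
hub-fits q = ≤-trans (m≤m+n (hubV q + hubV q) _)

-- Halving once for each of the `hubV q + hubV q` stars must leave `hubW q` parts, which is where
-- the power of two comes from.
hub-dense : ∀ q {n} → threshold q ≤ n → q * (hubW q * 2 ^ (hubV q + hubV q)) < 2 * n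
hub-dense q {n} h = begin-strict
  m                   <⟨ m<m+n m (s≤s z≤n) ⟩
  m + suc (margin q)  ≤⟨ m≤n+m _ (hubV q + hubV q) ⟩
  threshold q         ≤⟨ h ⟩
  n                   ≤⟨ m≤m+n n _ ⟩
  2 * n               ∎
  where
  open ≤-Reasoning
  m = q * (hubW q * 2 ^ (hubV q + hubV q))

margin-fits : ∀ q {n v} → threshold q ≤ n → n ≡ hubV q + v → margin q < v
margin-fits q {v = v} h refl = +-cancelˡ-≤ (hubV q) _ _ (begin
  hubV q + suc (margin q)  ≤⟨ +-mono-≤ (m≤m+n (hubV q) (hubV q)) (m≤n+m (suc (margin q)) _) ⟩
  threshold q              ≤⟨ h ⟩
  hubV q + v               ∎)
  where open ≤-Reasoning

-- Both sides have equally many parts, and the hub takes `reserve q + 3` more from the first than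
-- from the second; outside the hub the surplus is therefore on the second side.
outside-size : ∀ q {n v w} → n ≡ hubV q + v → n ≡ hubW q + w → w ≡ v + (reserve q + 3)
outside-size q {v = v} {w} refl e = +-cancelˡ-≡ (hubW q) _ _ (trans (sym e) (lemma (hubW q) (reserve q) v))
  where
  lemma : ∀ b k v → suc (suc (b + k + 1)) + v ≡ b + (v + (k + 3))
  lemma = solve-∀

-- The count that lets the cycle close: when the route has used `reserve q + 2` V-parts of the hub,
-- one fewer V-part than W-parts is left there, as a zigzag between two V-vertices requires.
zigzag-size : ∀ q {n u v} → n ≡ hubW q + reserve q + 1 → n ≡ u + v → u ≡ reserve q + 2 → hubW q ≡ suc v
zigzag-size q {v = v} e refl refl = +-cancelʳ-≡ (reserve q + 1) _ _ (trans (sym (+-assoc (hubW q) (reserve q) 1)) (trans (sym e) (lemma (reserve q) v)))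
  where
  lemma : ∀ k v → k + 2 + v ≡ suc v + (k + 1)
  lemma = solve-∀

-- Densities as counts

/-<⇒*-< : ∀ a b c d .{{_ : ℕ.NonZero b}} .{{_ : ℕ.NonZero d}} → (ℤ.+ a ℚ./ b) ℚ.< (ℤ.+ c ℚ./ d) → a * d < c * b
/-<⇒*-< a (suc b) c (suc d) h
  with ℚᵘₚ.<-respˡ-≃ (ℚₚ.toℚᵘ-fromℚᵘ (ℚᵘ.mkℚᵘ (ℤ.+ a) b))
         (ℚᵘₚ.<-respʳ-≃ (ℚₚ.toℚᵘ-fromℚᵘ (ℚᵘ.mkℚᵘ (ℤ.+ c) d)) (ℚₚ.toℚᵘ-mono-< h))
... | ℚᵘ.*<* l = ℤₚ.drop‿+<+ (subst₂ ℤ._<_ (sym (ℤₚ.pos-* a (suc d))) (sym (ℤₚ.pos-* c (suc b))) l)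

-- For ε = n / d, the choice q = 2 d gives 1 / q < ε.
half+1/q<½+ε : ∀ ε → 0ℚ ℚ.< ε → ∃[ q ] (ℤ.+ (suc q + 2) ℚ./ (2 * suc q)) ℚ.< ½ ℚ.+ ε
half+1/q<½+ε ε 0<ε with ε | ℚ.positive 0<ε
... | mkℚ +[1+ n ] d c | _ = q , ℚₚ.toℚᵘ-cancel-<
  (ℚᵘₚ.<-respˡ-≃ (ℚᵘₚ.≃-sym (ℚₚ.toℚᵘ-fromℚᵘ (ℚᵘ.mkℚᵘ (ℤ.+ (suc q + 2)) (q + 1 * suc q))))
    (ℚᵘₚ.<-respʳ-≃ (ℚᵘₚ.≃-sym (ℚₚ.toℚᵘ-homo-+ ½ (mkℚ +[1+ n ] d c)))
      (ℚᵘ.*<* (subst₂ ℤ._<_ (ℤₚ.pos-* (suc q + 2) (2 * suc d)) rhs (+<+ cross)))))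
  where
  q = suc (2 * d)
  rhs : ℤ.+ ((1 * suc d + suc n * 2) * (2 * suc q)) ≡ ((ℤ.+ 1) ℤ.* (ℤ.+ suc d) ℤ.+ +[1+ n ] ℤ.* (ℤ.+ 2)) ℤ.* (ℤ.+ (2 * suc q))
  rhs = trans (ℤₚ.pos-* (1 * suc d + suc n * 2) (2 * suc q))
          (cong (ℤ._* (ℤ.+ (2 * suc q))) (cong₂ ℤ._+_ (ℤₚ.pos-* 1 (suc d)) (ℤₚ.pos-* (suc n) 2)))
  lemma : ∀ d n → (suc (suc (2 * d)) + 2) * (2 * suc d) + (4 * suc d + 8 * n * suc d) ≡
                  (1 * suc d + suc n * 2) * (2 * suc (suc (2 * d)))
  lemma = solve-∀
  cross : (suc q + 2) * (2 * suc d) < (1 * suc d + suc n * 2) * (2 * suc q)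
  cross = subst ((suc q + 2) * (2 * suc d) <_) (lemma d n) (m<m+n _ (s≤s z≤n))

∑-filter : {P : A → Set} (P? : Decidable₁ P) (xs : List A) (f : A → ℕ) →
           ∑ (filter P? xs) f ≡ ∑[ x ∈ xs ] (𝟙 (P? x) * f x)
∑-filter P? [] f = refl
∑-filter P? (x ∷ xs) f with P? x
... | yes _ = cong₂ _+_ (sym (+-identityʳ (f x))) (∑-filter P? xs f)
... | no  _ = ∑-filter P? xs f

∑-map : ∀ (g : A → B) xs (f : B → ℕ) → ∑ (map g xs) f ≡ ∑[ x ∈ xs ] f (g x)
∑-map g []       f = refl
∑-map g (x ∷ xs) f = cong₂ _+_ refl (∑-map g xs f)

∑-cartesianProduct : ∀ (xs : List A) (ys : List B) (f : A × B → ℕ) →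
                     ∑ (cartesianProduct xs ys) f ≡ ∑[ x ∈ xs ] ∑[ y ∈ ys ] f (x , y)
∑-cartesianProduct []       ys f = refl
∑-cartesianProduct (x ∷ xs) ys f =
  trans (∑-++ (map (x ,_) ys) _ f) (cong₂ _+_ (∑-map (x ,_) ys f) (∑-cartesianProduct xs ys f))

𝟙-× : (d : Dec A) (e : Dec B) → 𝟙 (d ×-dec e) ≡ 𝟙 d * 𝟙 e
𝟙-× (yes _) (yes _) = refl
𝟙-× (yes _) (no _)  = refl
𝟙-× (no _)  _       = refl

elements : ∀ {n} → Subset n → List (Fin n)
elements {n} X = filter (_∈? X) (allFin n)

∣∣≡count : ∀ {n} (X : Subset n) → ∣ X ∣ ≡ count (_∈? X) (allFin n)
∣∣≡count [] = refl
∣∣≡count {suc n} (b ∷ X) = trans (head b) (cong (𝟙 (zero ∈? (b ∷ X)) +_) (sym tail))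
  where
  head : ∀ b → ∣ b ∷ X ∣ ≡ 𝟙 (zero ∈? (b ∷ X)) + count (_∈? X) (allFin n)
  head true  = cong suc (∣∣≡count X)
  head false = ∣∣≡count X
  tail : ∑ (tabulate suc) (λ x → 𝟙 (x ∈? (b ∷ X))) ≡ count (_∈? X) (allFin n)
  tail = trans (cong (λ l → ∑ l (λ x → 𝟙 (x ∈? (b ∷ X)))) (sym (map-tabulate (λ i → i) suc)))
    (trans (∑-map suc (allFin n) _) (∑-cong (allFin n) λ x → 𝟙-cong (suc x ∈? (b ∷ X)) (x ∈? X) drop-there Vec.there))

length-elements : ∀ {n} (X : Subset n) → length (elements X) ≡ ∣ X ∣
length-elements {n} X = trans (length-filter≡count (_∈? X) (allFin n)) (sym (∣∣≡count X))

e≡∑∑ : ∀ {n} (G : Graph n) X Y →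
       e G X Y ≡ ∑[ x ∈ elements X ] ∑[ y ∈ elements Y ] 𝟙 (Graph.adj? G x y)
e≡∑∑ {n} G X Y = begin
  e G X Y
    ≡⟨ length-filter≡count _ (cartesianProduct (allFin n) (allFin n)) ⟩
  ∑ (cartesianProduct (allFin n) (allFin n)) _
    ≡⟨ ∑-cartesianProduct (allFin n) (allFin n) _ ⟩
  ∑[ x ∈ allFin n ] ∑[ y ∈ allFin n ] 𝟙 ((x ∈? X) ×-dec ((y ∈? Y) ×-dec Graph.adj? G x y))
    ≡⟨ ∑-cong (allFin n) (λ x → trans
         (∑-cong (allFin n) (λ y → trans (𝟙-× (x ∈? X) _) (cong (𝟙 (x ∈? X) *_) (𝟙-× (y ∈? Y) _))))
         (trans (∑-*ˡ (𝟙 (x ∈? X)) (allFin n) _) (cong (𝟙 (x ∈? X) *_) (sym (∑-filter (_∈? Y) (allFin n) _))))) ⟩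
  ∑[ x ∈ allFin n ] (𝟙 (x ∈? X) * ∑[ y ∈ elements Y ] 𝟙 (Graph.adj? G x y))
    ≡⟨ ∑-filter (_∈? X) (allFin n) _ ⟨
  ∑[ x ∈ elements X ] ∑[ y ∈ elements Y ] 𝟙 (Graph.adj? G x y) ∎
  where open ≡-Reasoning

-- Equalising the sizes of the parts by repetition

repeat : ℕ → List A → List A
repeat c xs = concat (replicate c xs)

∑-repeat : ∀ c (xs : List A) f → ∑ (repeat c xs) f ≡ c * ∑ xs f
∑-repeat zero    xs f = refl
∑-repeat (suc c) xs f = trans (∑-++ xs (repeat c xs) f) (cong (∑ xs f +_) (∑-repeat c xs f))

length-repeat : ∀ c (xs : List A) → length (repeat c xs) ≡ c * length xs
length-repeat zero    xs = refl
length-repeat (suc c) xs = trans (length-++ xs) (cong (length xs +_) (length-repeat c xs))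

∈-repeat⁻ : ∀ c {xs : List A} {x} → x ∈ repeat c xs → x ∈ xs
∈-repeat⁻ (suc c) {xs} x∈ with ∈-++⁻ xs x∈
... | inj₁ x∈xs = x∈xs
... | inj₂ x∈′  = ∈-repeat⁻ c x∈′

-- Repeating the vertices multiplies the number of edges and the number of pairs by the same factor
-- `c * d`, so the density is unchanged.
repeat-dense : ∀ {n N} (G : Graph n) (X Y : Subset n) c d q → c * ∣ X ∣ ≡ N → d * ∣ Y ∣ ≡ N →
               (q + 2) * (∣ X ∣ * ∣ Y ∣) ≤ e G X Y * (2 * q) →
               (q + 2) * (N * N) ≤ 2 * q * ∑[ x ∈ repeat c (elements X) ] count (Graph.adj? G x) (repeat d (elements Y))
repeat-dense G X Y c d q refl cd h = begin
  (q + 2) * (c * ∣ X ∣ * (c * ∣ X ∣))  ≡⟨ cong (λ m → (q + 2) * (c * ∣ X ∣ * m)) cd ⟨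
  (q + 2) * (c * ∣ X ∣ * (d * ∣ Y ∣))  ≡⟨ lemma₁ q c (∣ X ∣) d (∣ Y ∣) ⟩
  c * d * ((q + 2) * (∣ X ∣ * ∣ Y ∣))  ≤⟨ *-monoʳ-≤ (c * d) h ⟩
  c * d * (e G X Y * (2 * q))          ≡⟨ lemma₂ q c d (e G X Y) ⟩
  2 * q * (c * (d * e G X Y))          ≡⟨ cong (2 * q *_) blow ⟨
  2 * q * ∑[ x ∈ repeat c (elements X) ] count (Graph.adj? G x) (repeat d (elements Y)) ∎
  where
  open ≤-Reasoning
  lemma₁ : ∀ q c x d y → (q + 2) * (c * x * (d * y)) ≡ c * d * ((q + 2) * (x * y))
  lemma₁ = solve-∀
  lemma₂ : ∀ q c d e → c * d * (e * (2 * q)) ≡ 2 * q * (c * (d * e))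
  lemma₂ = solve-∀
  blow : ∑[ x ∈ repeat c (elements X) ] count (Graph.adj? G x) (repeat d (elements Y)) ≡ c * (d * e G X Y)
  blow = trans (∑-repeat c (elements X) _) (cong (c *_) (trans
    (∑-cong (elements X) (λ x → ∑-repeat d (elements Y) _)) (trans (∑-*ˡ d (elements X) _) (cong (d *_) (sym (e≡∑∑ G X Y))))))

-- Stars, chains and bridges

-- The list `L p` may name a vertex of part `p` several times. As all lists have the common length
-- `N`, density at least `1/2 + 1/q` becomes the inequality `dense` between natural numbers.
module Core
  {P X : Set} (_≟ᵖ_ : DecidableEquality P)
  {E : X → X → Set} (E? : Decidable E) (E-sym : Symmetric E)
  (L : P → List X) {N : ℕ} (0<N : 0 < N) (∣L∣ : ∀ p → length (L p) ≡ N)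
  (side : P → Bool) (q : ℕ)
  (dense : ∀ {i j} → side i ≢ side j →
           (q + 2) * (N * N) ≤ 2 * q * ∑[ x ∈ L i ] count (E? x) (L j))
  where

  open CMSolver (++-commutativeMonoid {A = P}) using (solve; _⊕_; _⊜_)

  deg : X → P → ℕ
  deg x j = count (E? x) (L j)

  degs : List P → X → ℕ
  degs J x = ∑[ j ∈ J ] deg x j

  deg≤N : ∀ x j → deg x j ≤ N
  deg≤N x j = subst (deg x j ≤_) (∣L∣ j) (count-≤ (E? x) (L j))

  On : Bool → List P → Set
  On b J = All (λ j → side j ≡ b) J

  -- Averaged over the parts in J, x sees at least a fraction 1/2 + 1/q of a part;
  -- the error s pays for the parts that have been removed from J.
  record Star (s : ℕ) (J : List P) (x : X) : Set where
    constructor mkStar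
    field large : (q + 2) * N * length J ≤ 2 * q * degs J x + s * N

  open Star

  -- Exchanging the sums over `J` and `L i` turns the densities into a bound on the average of
  -- `degs J` over `L i`, which some vertex attains.
  star : ∀ {i J} → All (λ j → side i ≢ side j) J → ∃[ x ] x ∈ L i × Star 0 J x
  star {i} {J} ds =
    let x , x∈ , p = ∑-average (L i) (subst (0 <_) (sym (∣L∣ i)) 0<N) total
    in  x , x∈ , mkStar (m≤n⇒m≤n+o 0 p)
    where
    open ≤-Reasoning
    rearrange : ∀ n l q → n * ((q + 2) * n * l) ≡ l * ((q + 2) * (n * n))
    rearrange = solve-∀
    total : length (L i) * ((q + 2) * N * length J) ≤ ∑[ x ∈ L i ] (2 * q * degs J x)
    total = begin
      length (L i) * ((q + 2) * N * length J)    ≡⟨ cong (_* _) (∣L∣ i) ⟩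
      N * ((q + 2) * N * length J)               ≡⟨ rearrange N (length J) q ⟩
      length J * ((q + 2) * (N * N))             ≤⟨ ∑-≥ J (λ j∈ → dense (All.lookup ds j∈)) ⟩
      ∑[ j ∈ J ] (2 * q * ∑[ x ∈ L i ] deg x j)  ≡⟨ ∑-*ˡ (2 * q) J _ ⟩
      2 * q * ∑[ j ∈ J ] ∑[ x ∈ L i ] deg x j    ≡⟨ cong (2 * q *_) (∑-swap J (L i) (λ j x → deg x j)) ⟩
      2 * q * ∑[ x ∈ L i ] degs J x              ≡⟨ ∑-*ˡ (2 * q) (L i) _ ⟨
      ∑[ x ∈ L i ] (2 * q * degs J x)            ∎

  Star-↭ : ∀ {s J J′ x} → J ↭ J′ → Star s J x → Star s J′ x
  Star-↭ {x = x} p (mkStar h) rewrite ↭-length p | ∑-↭ (deg x) p = mkStar h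

  Star-weaken : ∀ {s s′ J x} → s ≤ s′ → Star s J x → Star s′ J x
  Star-weaken s≤s′ (mkStar h) = mkStar (≤-trans h (+-monoʳ-≤ _ (*-monoˡ-≤ N s≤s′)))

  -- Each removed part contributed at most `N` to `degs`, hence at most `2 * q * N` to the
  -- inequality.
  Star-drop : ∀ {s J x} us → Star s (us ++ J) x → Star (s + 2 * q * length us) J x
  Star-drop {s} {J} {x} us (mkStar h) = mkStar (begin
    (q + 2) * N * length J                          ≤⟨ *-monoʳ-≤ ((q + 2) * N) (m≤n+m _ (length us)) ⟩
    (q + 2) * N * (length us + length J)            ≡⟨ cong ((q + 2) * N *_) (length-++ us) ⟨
    (q + 2) * N * length (us ++ J)                  ≤⟨ h ⟩
    2 * q * degs (us ++ J) x + s * N                ≡⟨ cong (λ d → 2 * q * d + s * N) (∑-++ us J (deg x)) ⟩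
    2 * q * (degs us x + degs J x) + s * N          ≤⟨ +-monoˡ-≤ (s * N) (*-monoʳ-≤ (2 * q) (+-monoˡ-≤ (degs J x) (∑-≤ us λ {j} _ → deg≤N x j))) ⟩
    2 * q * (length us * N + degs J x) + s * N      ≡⟨ rearrange q (length us) N (degs J x) s ⟩
    2 * q * degs J x + (s + 2 * q * length us) * N  ∎)
    where
    open ≤-Reasoning
    rearrange : ∀ q u n d s → 2 * q * (u * n + d) + s * n ≡ 2 * q * d + (s + 2 * q * u) * n
    rearrange = solve-∀

  -- The parts listed are those visited after the starting vertex.
  data Trail : X → List P → X → Set where
    []  : ∀ {x} → Trail x [] x
    _∷_ : ∀ {x y z p ps} → E x y × y ∈ L p → Trail y ps z → Trail x (p ∷ ps) z

  _++ᵗ_ : ∀ {x y z ps qs} → Trail x ps y → Trail y qs z → Trail x (ps ++ qs) z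
  []      ++ᵗ t = t
  (e ∷ s) ++ᵗ t = e ∷ (s ++ᵗ t)

  -- The two stars together see on average more than `N` entries per part, the errors being
  -- outweighed by the surplus `4 * length J`. In some part the two degrees then add up to more than
  -- `N`, and the neighbourhoods meet.
  link : ∀ {s s′ J x x′} → Star s J x → Star s′ J x′ → s + s′ < 4 * length J →
         ∃[ j ] ∃[ y ] j ∈ J × y ∈ L j × E x y × E y x′
  link {s} {s′} {J} {x} {x′} (mkStar h) (mkStar h′) l =
    let j , j∈ , p = ∑-exceeds J (subst (length J * N <_) (sym (∑-+ J (deg x) (deg x′))) total)
        y , y∈ , r = ∑-exceeds (L j) (subst₂ _<_ (trans (sym (∣L∣ j)) (sym (*-identityʳ _)))
                                                (sym (∑-+ (L j) _ _)) p)
        xy , x′y = both (E? x y) (E? x′ y) r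
    in  j , y , j∈ , y∈ , xy , E-sym x′y
    where
    both : ∀ {A B : Set} (d : Dec A) (e : Dec B) → 1 < 𝟙 d + 𝟙 e → A × B
    both (yes a) (yes b) _ = a , b
    both (yes _) (no _)  (s≤s ())
    both (no _)  (yes _) (s≤s ())
    both (no _)  (no _)  ()
    lhs : ∀ q n l → 2 * q * (l * n) + 4 * l * n ≡ (q + 2) * n * l + (q + 2) * n * l
    lhs = solve-∀
    rhs : ∀ q n d d′ s s′ → 2 * q * d + s * n + (2 * q * d′ + s′ * n) ≡ 2 * q * (d + d′) + (s + s′) * n
    rhs = solve-∀
    total : length J * N < degs J x + degs J x′
    total = *-cancelˡ-< (2 * q) _ _ (+-cancelʳ-< ((s + s′) * N) _ _ (begin-strict
      2 * q * (length J * N) + (s + s′) * N      <⟨ +-monoʳ-< _ (*-monoˡ-< N {{ℕ.>-nonZero 0<N}} l) ⟩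
      2 * q * (length J * N) + 4 * length J * N  ≡⟨ lhs q N (length J) ⟩
      (q + 2) * N * length J + (q + 2) * N * length J ≤⟨ +-mono-≤ h h′ ⟩
      2 * q * degs J x + s * N + (2 * q * degs J x′ + s′ * N)
                                                      ≡⟨ rhs q N (degs J x) (degs J x′) s s′ ⟩
      2 * q * (degs J x + degs J x′) + (s + s′) * N   ∎))
      where open ≤-Reasoning

  opposite : ∀ {b i J} → side i ≡ b → On (not b) J → All (λ j → side i ≢ side j) J
  opposite si on = All.map (λ sj si≡sj → not-¬ (trans (sym si≡sj) si) sj) on

  -- The error of `x` is not inherited: `x′` is a fresh star of part `i` relative to `J`, and only
  -- the removal of `j` has to be paid for.
  extend : ∀ {s J x i} → All (λ j → side i ≢ side j) J → Star s J x → s < 4 * length J →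
           ∃[ j ] ∃[ J′ ] ∃[ x′ ] J ↭ j ∷ J′ × Trail x (j ∷ i ∷ []) x′ × Star (2 * q) J′ x′
  extend {s} {J} {i = i} ds h l =
    let x′ , x′∈ , h′ = star ds
        j , y , j∈ , y∈ , xy , yx′ = link h h′ (subst (_< 4 * length J) (sym (+-identityʳ s)) l)
        J′ , p = extract j∈
    in  j , J′ , x′ , p , ((xy , y∈) ∷ (yx′ , x′∈) ∷ []) ,
        subst (λ s → Star s J′ x′) (*-identityʳ (2 * q)) (Star-drop (j ∷ []) (Star-↭ p h′))

  -- Every new star is taken relative to the parts that are still unused, so the error never
  -- exceeds 2 q and the chain runs until J is almost exhausted.
  chain : ∀ {b s J x i} I → On b (i ∷ I) → On (not b) J → Star s J x →
          s < 4 * length J → length I + suc q ≤ length J →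
          ∃[ U ] ∃[ J′ ] ∃[ x′ ] ∃[ ps ]
            J ↭ U ++ J′ × length U ≡ suc (length I) ×
            Trail x ps x′ × ps ↭ U ++ (i ∷ I) × Star (2 * q) J′ x′
  chain {i = i} [] (si ∷ []) oJ h l _ =
    let j , J′ , x′ , p , t , h′ = extend (opposite si oJ) h l
    in  [ j ] , J′ , x′ , _ , p , refl , t , ↭-refl , h′
  chain {i = i} (i′ ∷ I) (si ∷ oI) oJ h l c =
    let j , J′ , x′ , p , t , h′ = extend (opposite si oJ) h l
        c′ = ℕ.s≤s⁻¹ (subst (_ ≤_) (↭-length p) c)
        U , J″ , x″ , ps , p′ , lU , t′ , ↭ps , h″ =
          chain I oI (All.tail (All-resp-↭ p oJ)) h′ (l′ (≤-trans (m≤n+m (suc q) (length I)) c′)) c′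
    in  j ∷ U , J″ , x″ , _ , ↭-trans p (prep j p′) , cong suc lU , t ++ᵗ t′ ,
        prep j (↭-trans (prep i ↭ps) (↭-sym (shift i U (i′ ∷ I)))) , h″
    where
    l′ : ∀ {k} → suc q ≤ k → 2 * q < 4 * k
    l′ {k} q<k = begin-strict
      2 * q  <⟨ *-monoʳ-< 2 q<k ⟩
      2 * k  ≤⟨ *-monoˡ-≤ k {2} {4} (s≤s (s≤s z≤n)) ⟩
      4 * k  ∎
      where open ≤-Reasoning

  -- Here the chain must end at the prescribed star `t`, whose error grows by `2 * q` with each part
  -- removed from `J`, while `4 * length J` drops by 4. This explains the cost `2 * q + 4` per part
  -- of `I`. The condition `2 * q ≤ s` lets every fresh star be used with the same error `s`.
  chain-to : ∀ {b s s′ J x t pt} I → On b I → On (not b) J → t ∈ L pt →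
             Star s J x → 2 * q ≤ s → Star s′ J t →
             s + s′ + (2 * q + 4) * length I < 4 * length J →
             ∃[ U ] ∃[ J′ ] ∃[ ps ]
               J ↭ U ++ J′ × length U ≡ suc (length I) × Trail x ps t × ps ↭ U ++ (pt ∷ I)
  chain-to {s = s} {s′} {J} [] _ oJ t∈ h q≤s ht l =
    let j , y , j∈ , y∈ , xy , yt = link h ht (subst (_< 4 * length J) (lemma s s′ q) l)
        J′ , p = extract j∈
    in  [ j ] , J′ , _ , p , refl , ((xy , y∈) ∷ (yt , t∈) ∷ []) , ↭-refl
    where
    lemma : ∀ s s′ q → s + s′ + (2 * q + 4) * 0 ≡ s + s′
    lemma = solve-∀
  chain-to {s = s} {s′} {J} {t = t} {pt} (i ∷ I) (si ∷ oI) oJ t∈ h q≤s ht l =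
    let j , J′ , x′ , p , tr , h′ = extend (opposite si oJ) h (≤-<-trans (≤-trans (m≤m+n s s′) (m≤m+n (s + s′) _)) l)
        ht′ = subst (λ s → Star (s′ + s) J′ t) (*-identityʳ (2 * q)) (Star-drop (j ∷ []) (Star-↭ p ht))
        U , J″ , ps , p′ , lU , tr′ , ↭ps =
          chain-to I oI (All.tail (All-resp-↭ p oJ)) t∈ (Star-weaken q≤s h′) q≤s ht′
            (+-cancelʳ-< 4 _ _ (subst₂ _<_ (lhs s s′ q (length I)) (trans (cong (4 *_) (↭-length p)) (rhs (length J′))) l))
    in  j ∷ U , J″ , _ , ↭-trans p (prep j p′) , cong suc lU , tr ++ᵗ tr′ ,
        prep j (↭-trans (prep i ↭ps) (solve 4 (λ i U pt I → i ⊕ U ⊕ pt ⊕ I ⊜ U ⊕ pt ⊕ i ⊕ I) ↭-refl [ i ] U [ pt ] I))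
    where
    lhs : ∀ s s′ q l → s + s′ + (2 * q + 4) * suc l ≡ s + (s′ + 2 * q) + (2 * q + 4) * l + 4
    lhs = solve-∀
    rhs : ∀ k → 4 * suc k ≡ 4 * k + 4
    rhs = solve-∀

  -- Bridges between stars of opposite sides

  module Bridge (I J : List P) (x₀ y₀ : X) where

    ThroughJ : X → P → Set
    ThroughJ x j = Any (λ y → E x₀ y × E y x) (L j)

    ThroughI : X → P → Set
    ThroughI y i = Any (λ x → E y x × E x y₀) (L i)

    Short : Set
    Short = Any (λ i → Any (λ x → E x y₀ × Any (ThroughJ x) J) (L i)) I

    -- The path `x₀ y₁ x y x₁ y₀`, described from its middle edge `x y`. The inequalities keep it
    -- from visiting a part twice, and searching through lists makes its existence decidable.
    Long : Set
    Long = Any (λ i → Any (λ x → Any (λ j → Any (λ y →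
             E x y × Any (λ j₁ → j ≢ j₁ × ThroughJ x j₁) J × Any (λ i₁ → i ≢ i₁ × ThroughI y i₁) I)
             (L j)) J) (L i)) I

    throughJ? : ∀ x j → Dec (ThroughJ x j)
    throughJ? x j = any? (λ y → E? x₀ y ×-dec E? y x) (L j)

    throughI? : ∀ y i → Dec (ThroughI y i)
    throughI? y i = any? (λ x → E? y x ×-dec E? x y₀) (L i)

    short? : Dec Short
    short? = any? (λ i → any? (λ x → E? x y₀ ×-dec any? (throughJ? x) J) (L i)) I

    long? : Dec Long
    long? = any? (λ i → any? (λ x → any? (λ j → any? (λ y →
              E? x y ×-dec any? (λ j₁ → ¬? (j ≟ᵖ j₁) ×-dec throughJ? x j₁) J
                     ×-dec any? (λ i₁ → ¬? (i ≟ᵖ i₁) ×-dec throughI? y i₁) I)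
              (L j)) J) (L i)) I

    short-path : Short → ∃[ i ] ∃[ x ] ∃[ j ] ∃[ y ]
                 i ∈ I × x ∈ L i × j ∈ J × y ∈ L j × E x₀ y × E y x × E x y₀
    short-path short with find short
    ... | i , i∈ , r with find r
    ...   | x , x∈ , xy₀ , r with find r
    ...     | j , j∈ , r with find r
    ...       | y , y∈ , x₀y , yx = i , x , j , y , i∈ , x∈ , j∈ , y∈ , x₀y , yx , xy₀

    long-path : Long → ∃[ i ] ∃[ x ] ∃[ j ] ∃[ y ] ∃[ i₁ ] ∃[ x₁ ] ∃[ j₁ ] ∃[ y₁ ]
                (i ∈ I × i₁ ∈ I × i ≢ i₁) × (j ∈ J × j₁ ∈ J × j ≢ j₁) ×
                (x ∈ L i × y ∈ L j × x₁ ∈ L i₁ × y₁ ∈ L j₁) ×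
                (E x₀ y₁ × E y₁ x × E x y × E y x₁ × E x₁ y₀)
    long-path long with find long
    ... | i , i∈ , r with find r
    ...   | x , x∈ , r with find r
    ...     | j , j∈ , r with find r
    ...       | y , y∈ , xy , rj , ri with find rj | find ri
    ...         | j₁ , j₁∈ , j≢j₁ , r | i₁ , i₁∈ , i≢i₁ , r′ with find r | find r′
    ...           | y₁ , y₁∈ , x₀y₁ , y₁x | x₁ , x₁∈ , yx₁ , x₁y₀ =
      i , x , j , y , i₁ , x₁ , j₁ , y₁ , (i∈ , i₁∈ , i≢i₁) , (j∈ , j₁∈ , j≢j₁) ,
      (x∈ , y∈ , x₁∈ , y₁∈) , (x₀y₁ , y₁x , xy , yx₁ , x₁y₀)

    manyJ? : ∀ x → Dec (2 ≤ count (throughJ? x) J)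
    manyJ? x = 2 ≤? count (throughJ? x) J

    manyI? : ∀ y → Dec (2 ≤ count (throughI? y) I)
    manyI? y = 2 ≤? count (throughI? y) I

    -- If x is reached from x₀ through one part only, that part may be the one containing the
    -- next vertex y of the path.  For each x there is at most one such part, so the total error
    -- is of lower order.
    errJ : P → X → ℕ
    errJ j x = 𝟙 (throughJ? x j ×-dec ¬? (manyJ? x))

    errI : P → X → ℕ
    errI i y = 𝟙 (throughI? y i ×-dec ¬? (manyI? y))

    module _ (I! : Unique I) (J! : Unique J) (¬short : ¬ Short) (¬long : ¬ Long)
             (halfJ : ∀ {j} → j ∈ J → N ≤ 2 * deg x₀ j) (halfI : ∀ {i} → i ∈ I → N ≤ 2 * deg y₀ i)
             where

      few : ∀ {j x} → N ≤ 2 * deg x j → let t = count (λ y → ¬? (E? x y)) (L j) in t + t ≤ N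
      few {j} {x} h = +-cancelʳ-≤ N _ _ (begin
        t + t + N            ≤⟨ +-monoʳ-≤ (t + t) h ⟩
        t + t + 2 * deg x j  ≡⟨ lemma t (deg x j) ⟩
        deg x j + t + (deg x j + t) ≡⟨ cong₂ _+_ total total ⟩
        N + N                       ∎)
        where
        open ≤-Reasoning
        t = count (λ y → ¬? (E? x y)) (L j)
        total : deg x j + t ≡ N
        total = trans (count+count¬ (E? x) (L j)) (∣L∣ j)
        lemma : ∀ t d → t + t + 2 * d ≡ d + t + (d + t)
        lemma = solve-∀

      -- If `y₀` is reached from `y` and `x₀` sees `y`, then `x₀ y x y₀` is a short path.
      many≤ : ∀ {j} → j ∈ J → count manyI? (L j) ≤ count (λ y → ¬? (E? x₀ y)) (L j)
      many≤ {j} j∈ = ∑-mono (L j) λ {y} y∈ → 𝟙-mono (manyI? y) (¬? (E? x₀ y)) λ my x₀y →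
        let i , i∈ , r = find (any-of (throughI? y) (≤-trans (s≤s z≤n) my))
            x , x∈ , yx , xy₀ = find r
        in  ¬short (lose i∈ (lose x∈ (xy₀ , lose j∈ (lose y∈ (x₀y , yx)))))

      -- If `y₀` sees `x`, each neighbour of `x` reaches `y₀` through `i`, so it is counted by
      -- `manyI?` or by `errI`. If not, but `x` is reached through two parts, a neighbour counted by
      -- `manyI?` would give a long path. In the remaining case a neighbour of `x` seen by `x₀` is
      -- charged to `errJ`, and the vertices not seen by `x₀` are at most half of `L j`, hence no
      -- more than those outside `manyI?`.
      deg≤ : ∀ {i j x} → i ∈ I → j ∈ J → x ∈ L i →
             deg x j ≤ 𝟙 (E? y₀ x) * count manyI? (L j) + 𝟙 (¬? (E? y₀ x)) * count (λ y → ¬? (manyI? y)) (L j)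
                       + (N * errJ j x + ∑ (L j) (errI i))
      deg≤ {i} {j} {x} i∈ j∈ x∈ with E? y₀ x | manyJ? x
      ... | yes y₀x | _ = begin
        deg x j                                 ≤⟨ ∑-mono (L j) (λ {y} _ → pointwise y) ⟩
        ∑[ y ∈ L j ] (𝟙 (manyI? y) + errI i y)  ≡⟨ ∑-+ (L j) _ _ ⟩
        a + c                                   ≤⟨ +-mono-≤ (≤-reflexive (sym (trans (+-identityʳ (1 * a)) (*-identityˡ a)))) (m≤n+m c _) ⟩
        _                                       ∎
        where
        open ≤-Reasoning
        a = count manyI? (L j)
        c = ∑ (L j) (errI i)
        pointwise : ∀ y → 𝟙 (E? x y) ≤ 𝟙 (manyI? y) + errI i y
        pointwise y with E? x y
        ... | no _ = z≤n
        ... | yes xy with manyI? y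
        ...   | yes _ = s≤s z≤n
        ...   | no  m = ≤-reflexive (sym (𝟙-yes (throughI? y i ×-dec ¬? (no m)) (lose x∈ (E-sym xy , E-sym y₀x) , m)))
      ... | no _ | yes mx = begin
        deg x j  ≤⟨ ∑-mono (L j) pointwise ⟩
        b        ≡⟨ *-identityˡ b ⟨
        1 * b    ≤⟨ m≤m+n (1 * b) _ ⟩
        _        ∎
        where
        open ≤-Reasoning
        b = count (λ y → ¬? (manyI? y)) (L j)
        pointwise : ∀ {y} → y ∈ L j → 𝟙 (E? x y) ≤ 𝟙 (¬? (manyI? y))
        pointwise {y} y∈ = 𝟙-mono (E? x y) (¬? (manyI? y)) λ xy my →
          ¬long (lose i∈ (lose x∈ (lose j∈ (lose y∈
            (xy , element-other-than (throughJ? x) J! mx j (j ≟ᵖ_) , element-other-than (throughI? y) I! my i (i ≟ᵖ_))))))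
      ... | no _ | no mx = begin
        deg x j                                               ≤⟨ ∑-mono (L j) pointwise ⟩
        ∑[ y ∈ L j ] (𝟙 (¬? (E? x₀ y)) + 𝟙 (throughJ? x j ×-dec ¬? (no mx)))
                                                              ≡⟨ ∑-+ (L j) _ _ ⟩
        t + ∑[ _ ∈ L j ] ε  ≡⟨ cong (t +_) (trans (∑-const (L j) ε) (cong (_* ε) (∣L∣ j))) ⟩
        t + N * ε           ≤⟨ +-mono-≤ (≤-trans t≤b (≤-reflexive (sym (*-identityˡ b)))) (m≤m+n (N * ε) _) ⟩
        _                   ∎
        where
        open ≤-Reasoning
        ε = 𝟙 (throughJ? x j ×-dec ¬? (no mx))
        a = count manyI? (L j)
        b = count (λ y → ¬? (manyI? y)) (L j)
        t = count (λ y → ¬? (E? x₀ y)) (L j)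
        pointwise : ∀ {y} → y ∈ L j → 𝟙 (E? x y) ≤ 𝟙 (¬? (E? x₀ y)) + ε
        pointwise {y} y∈ with E? x y | E? x₀ y
        ... | no _   | _        = z≤n
        ... | yes _  | no _     = s≤s z≤n
        ... | yes xy | yes x₀y  = ≤-reflexive (sym (𝟙-yes (throughJ? x j ×-dec ¬? (no mx)) (lose y∈ (x₀y , E-sym xy) , mx)))
        t≤b : t ≤ b
        t≤b = +-cancelˡ-≤ t t b (begin
          t + t  ≤⟨ few (halfJ j∈) ⟩
          N      ≡⟨ trans (count+count¬ manyI? (L j)) (∣L∣ j) ⟨
          a + b  ≤⟨ +-monoˡ-≤ b (many≤ j∈) ⟩
          t + b  ∎)


      -- At least half of `L i` is seen by `y₀`, while at most half of `L j` satisfies `manyI?`. The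
      -- two products in `deg≤` are thus oppositely ordered, and Chebyshev's inequality bounds the
      -- main term by half of `N * N`.
      pair-bound : ∀ {i j} → i ∈ I → j ∈ J →
                   2 * ∑[ x ∈ L i ] deg x j ≤
                   N * N + (2 * N * ∑ (L i) (errJ j) + 2 * N * ∑ (L j) (errI i))
      pair-bound {i} {j} i∈ j∈ = begin
        2 * ∑[ x ∈ L i ] deg x j                                   ≤⟨ *-monoʳ-≤ 2 (∑-mono (L i) (deg≤ i∈ j∈)) ⟩
        2 * ∑[ x ∈ L i ] (f x * a + g x * b + (N * errJ j x + c))  ≡⟨ cong (2 *_) expand ⟩
        2 * (∑ (L i) f * a + ∑ (L i) g * b + (N * ∑ (L i) (errJ j) + N * c))
                                                                      ≡⟨ lemma (∑ (L i) f * a + ∑ (L i) g * b) N (∑ (L i) (errJ j)) c ⟩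
        2 * (∑ (L i) f * a + ∑ (L i) g * b) + (2 * N * ∑ (L i) (errJ j) + 2 * N * c)
                                                                      ≤⟨ +-monoˡ-≤ _ main ⟩
        N * N + (2 * N * ∑ (L i) (errJ j) + 2 * N * c)                ∎
        where
        open ≤-Reasoning
        f = λ x → 𝟙 (E? y₀ x)
        g = λ x → 𝟙 (¬? (E? y₀ x))
        a = count manyI? (L j)
        b = count (λ y → ¬? (manyI? y)) (L j)
        c = ∑ (L j) (errI i)
        a+b : a + b ≡ N
        a+b = trans (count+count¬ manyI? (L j)) (∣L∣ j)
        f+g : ∑ (L i) f + ∑ (L i) g ≡ N
        f+g = trans (count+count¬ (E? y₀) (L i)) (∣L∣ i)
        halve : ∀ {u v} → u + v ≡ N → u + u ≤ N → u ≤ v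
        halve {u} {v} e h = +-cancelˡ-≤ u u v (≤-trans h (≤-reflexive (sym e)))
        main : 2 * (∑ (L i) f * a + ∑ (L i) g * b) ≤ N * N
        main = subst₂ (λ m n → 2 * (∑ (L i) f * a + ∑ (L i) g * b) ≤ m * n) f+g a+b
          (opposite-sorted {∑ (L i) f} {a} {∑ (L i) g} {b} (halve {∑ (L i) g} {∑ (L i) f} (trans (+-comm (∑ (L i) g) _) f+g) (few (halfI i∈)))
                           (halve {a} {b} a+b (≤-trans (+-mono-≤ (many≤ j∈) (many≤ j∈)) (few (halfJ j∈)))))
        lemma : ∀ m n e c → 2 * (m + (n * e + n * c)) ≡ 2 * m + (2 * n * e + 2 * n * c)
        lemma = solve-∀
        expand : ∑[ x ∈ L i ] (f x * a + g x * b + (N * errJ j x + c)) ≡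
                 ∑ (L i) f * a + ∑ (L i) g * b + (N * ∑ (L i) (errJ j) + N * c)
        expand = trans (∑-+ (L i) _ _) (cong₂ _+_
          (trans (∑-+ (L i) _ _) (cong₂ _+_ (∑-*ʳ (L i) f a) (∑-*ʳ (L i) g b)))
          (trans (∑-+ (L i) _ _) (cong₂ _+_ (∑-*ˡ N (L i) _) (trans (∑-const (L i) c) (cong (_* c) (∣L∣ i))))))

      -- Summed over all parts, the errors at one vertex amount to at most 1 by `lonely≤1`. The
      -- error is therefore linear in the numbers of parts, whereas the main term is their product.
      total-bound : ∑[ i ∈ I ] ∑[ j ∈ J ] (2 * ∑[ x ∈ L i ] deg x j) ≤
                    N * N * (length I * length J + 2 * (length I + length J))
      total-bound = begin
        ∑[ i ∈ I ] ∑[ j ∈ J ] (2 * ∑[ x ∈ L i ] deg x j)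
          ≤⟨ ∑-mono I (λ i∈ → ∑-mono J (pair-bound i∈)) ⟩
        ∑[ i ∈ I ] ∑[ j ∈ J ] (N * N + (2 * N * ∑ (L i) (errJ j) + 2 * N * ∑ (L j) (errI i)))
          ≡⟨ ∑-cong I (λ i → trans (∑-+ J _ _) (cong₂ _+_ (∑-const J (N * N)) (∑-+ J _ _))) ⟩
        ∑[ i ∈ I ] (length J * (N * N) + (∑[ j ∈ J ] (2 * N * ∑ (L i) (errJ j)) + ∑[ j ∈ J ] (2 * N * ∑ (L j) (errI i))))
          ≡⟨ trans (∑-+ I _ _) (cong₂ _+_ (∑-const I _) (∑-+ I _ _)) ⟩
        length I * (length J * (N * N)) + (∑[ i ∈ I ] ∑[ j ∈ J ] (2 * N * ∑ (L i) (errJ j)) + ∑[ i ∈ I ] ∑[ j ∈ J ] (2 * N * ∑ (L j) (errI i)))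
          ≤⟨ +-monoʳ-≤ (length I * (length J * (N * N))) (+-mono-≤
               (∑-≤ I (λ {i} _ → err (throughJ?) J i))
               (≤-trans (≤-reflexive (∑-swap I J _)) (∑-≤ J (λ {j} _ → err (throughI?) I j)))) ⟩
        length I * (length J * (N * N)) + (length I * (2 * N * (N * 1)) + length J * (2 * N * (N * 1)))
          ≡⟨ lemma (length I) (length J) N ⟩
        N * N * (length I * length J + 2 * (length I + length J)) ∎
        where
        open ≤-Reasoning
        lemma : ∀ i j n → i * (j * (n * n)) + (i * (2 * n * (n * 1)) + j * (2 * n * (n * 1))) ≡
                          n * n * (i * j + 2 * (i + j))
        lemma = solve-∀
        err : ∀ {T : X → P → Set} (T? : ∀ x p → Dec (T x p)) (K : List P) p →
              ∑[ k ∈ K ] (2 * N * ∑[ x ∈ L p ] 𝟙 (T? x k ×-dec ¬? (2 ≤? count (T? x) K))) ≤ 2 * N * (N * 1)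
        err T? K p = ≤-trans
          (≤-reflexive (trans (∑-*ˡ (2 * N) K _) (cong (2 * N *_) (∑-swap K (L p) _))))
          (*-monoʳ-≤ (2 * N) (subst (λ n → _ ≤ n * 1) (∣L∣ p) (∑-≤ (L p) (λ {x} _ → lonely≤1 (T? x) K))))

      -- The density hypothesis exceeds the main term of `total-bound` by a fraction `2/q` of it;
      -- `big` says that this is more than the linear error. The term `2 * N * N * m` is added on
      -- both sides to avoid subtraction.
      impossible : (∀ {i j} → i ∈ I → j ∈ J → side i ≢ side j) →
                   q * (length I + length J) < length I * length J → ⊥
      impossible sides big = <-irrefl refl (begin-strict
        (q + 2) * (N * N) * m + 2 * N * N * (q * s)
          <⟨ +-monoʳ-< ((q + 2) * (N * N) * m) (*-monoʳ-< (2 * N * N) big) ⟩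
        (q + 2) * (N * N) * m + 2 * N * N * m
          ≡⟨ lemma₁ q N (length I) (length J) ⟩
        length I * (length J * ((q + 2) * (N * N))) + 2 * N * N * m
          ≤⟨ +-monoˡ-≤ (2 * N * N * m) (∑-≥ I (λ i∈ → ∑-≥ J (λ j∈ → dense (sides i∈ j∈)))) ⟩
        ∑[ i ∈ I ] ∑[ j ∈ J ] (2 * q * ∑[ x ∈ L i ] deg x j) + 2 * N * N * m
          ≡⟨ cong (_+ 2 * N * N * m) (trans (∑-cong I (λ i → trans (∑-cong J (λ j → lemma₂ q _)) (∑-*ˡ q J _))) (∑-*ˡ q I _)) ⟩
        q * ∑[ i ∈ I ] ∑[ j ∈ J ] (2 * ∑[ x ∈ L i ] deg x j) + 2 * N * N * m
          ≤⟨ +-monoˡ-≤ (2 * N * N * m) (*-monoʳ-≤ q total-bound) ⟩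
        q * (N * N * (m + 2 * s)) + 2 * N * N * m
          ≡⟨ lemma₃ q N m s ⟩
        (q + 2) * (N * N) * m + 2 * N * N * (q * s) ∎)
        where
        open ≤-Reasoning
        m = length I * length J
        s = length I + length J
        instance
          _ = ℕ.>-nonZero 0<N
          _ = m*n≢0 2 N
          _ = m*n≢0 (2 * N) N
        lemma₁ : ∀ q n i j → (q + 2) * (n * n) * (i * j) + 2 * n * n * (i * j) ≡
                             i * (j * ((q + 2) * (n * n))) + 2 * n * n * (i * j)
        lemma₁ = solve-∀
        lemma₂ : ∀ q e → 2 * q * e ≡ q * (2 * e)
        lemma₂ = solve-∀
        lemma₃ : ∀ q n m s → q * (n * n * (m + 2 * s)) + 2 * n * n * m ≡
                             (q + 2) * (n * n) * m + 2 * n * n * (q * s)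
        lemma₃ = solve-∀

    connected : Unique I → Unique J →
                (∀ {j} → j ∈ J → N ≤ 2 * deg x₀ j) → (∀ {i} → i ∈ I → N ≤ 2 * deg y₀ i) →
                (∀ {i j} → i ∈ I → j ∈ J → side i ≢ side j) →
                q * (length I + length J) < length I * length J → Short ⊎ Long
    -- Both kinds of path are decidable, so refuting their absence produces one.
    connected I! J! halfJ halfI sides big = decidable-stable (short? ⊎-dec long?)
      λ none → impossible I! J! (λ s → none (inj₁ s)) (λ l → none (inj₂ l)) halfJ halfI sides big

  Joined : List P → List P → X → P → X → Set
  Joined I J x₀ p y₀ =
    ∃[ Iᵤ ] ∃[ Jᵤ ] ∃[ I′ ] ∃[ J′ ] ∃[ ps ]
      I ↭ Iᵤ ++ I′ × J ↭ Jᵤ ++ J′ × length Iᵤ ≡ length Jᵤ × length Jᵤ ≤ 2 ×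
      Trail x₀ ps y₀ × ps ↭ Jᵤ ++ Iᵤ ++ [ p ]

  module _ {I J I⁺ J⁺ : List P} (I⁺⊆I : ∀ {i} → i ∈ I⁺ → i ∈ I) (J⁺⊆J : ∀ {j} → j ∈ J⁺ → j ∈ J)
           {x₀ y₀ : X} {p : P} (y₀∈ : y₀ ∈ L p) where
    open Bridge I⁺ J⁺ x₀ y₀

    short⇒joined : Short → Joined I J x₀ p y₀
    short⇒joined short with short-path short
    ... | i , x , j , y , i∈ , x∈ , j∈ , y∈ , x₀y , yx , xy₀
      with extract (I⁺⊆I i∈) | extract (J⁺⊆J j∈)
    ...   | I′ , pI | J′ , pJ =
      [ i ] , [ j ] , I′ , J′ , _ , pI , pJ , refl , s≤s z≤n ,
      ((x₀y , y∈) ∷ (yx , x∈) ∷ (xy₀ , y₀∈) ∷ []) , ↭-refl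

    long⇒joined : Long → Joined I J x₀ p y₀
    long⇒joined long with long-path long
    ... | i , x , j , y , i₁ , x₁ , j₁ , y₁ , (i∈ , i₁∈ , i≢i₁) , (j∈ , j₁∈ , j≢j₁) ,
          (x∈ , y∈ , x₁∈ , y₁∈) , (x₀y₁ , y₁x , xy , yx₁ , x₁y₀)
      with extract₂ (I⁺⊆I i∈) (I⁺⊆I i₁∈) i≢i₁ | extract₂ (J⁺⊆J j∈) (J⁺⊆J j₁∈) j≢j₁
    ...   | I′ , pI | J′ , pJ =
      i ∷ i₁ ∷ [] , j ∷ j₁ ∷ [] , I′ , J′ , _ , pI , pJ , refl , s≤s (s≤s z≤n) ,
      ((x₀y₁ , y₁∈) ∷ (y₁x , x∈) ∷ (xy , y∈) ∷ (yx₁ , x₁∈) ∷ (x₁y₀ , y₀∈) ∷ []) ,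
      solve 5 (λ j₁ i j i₁ p → j₁ ⊕ i ⊕ j ⊕ i₁ ⊕ p ⊜ (j ⊕ j₁) ⊕ (i ⊕ i₁) ⊕ p) ↭-refl [ j₁ ] [ i ] [ j ] [ i₁ ] [ p ]

  -- The argument is applied only to the parts of which the respective star sees at least half. By
  -- `many-heavy` with `M = N` there are more than `2 * q` of them on each side, enough for the
  -- product to beat the linear error.
  bridge : ∀ {b s s′ I J x₀ y₀ p} → Unique I → Unique J → On b I → On (not b) J → y₀ ∈ L p →
           Star s J x₀ → s + q * (2 * q) < 2 * length J →
           Star s′ I y₀ → s′ + q * (2 * q) < 2 * length I →
           Joined I J x₀ p y₀
  bridge {b} {s} {s′} {I} {J} {x₀} {y₀} {p} I! J! oI oJ y₀∈ hx lJ hy lI =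
    [ short⇒joined I⁺⊆I J⁺⊆J y₀∈ , long⇒joined I⁺⊆I J⁺⊆J y₀∈ ]′
      (Bridge.connected (filter heavyI? I) (filter heavyJ? J) x₀ y₀
        (Uniqueₚ.filter⁺ heavyI? I!) (Uniqueₚ.filter⁺ heavyJ? J!)
        (λ j∈ → proj₂ (∈-filter⁻ heavyJ? {xs = J} j∈)) (λ i∈ → proj₂ (∈-filter⁻ heavyI? {xs = I} i∈))
        (λ i∈ j∈ → All.lookup (opposite (All.lookup oI (I⁺⊆I i∈)) oJ) (J⁺⊆J j∈))
        (both-large (heavy J lJ hx) (heavy I lI hy)))
    where
    heavyI? = λ i → N ≤? 2 * deg y₀ i
    heavyJ? = λ j → N ≤? 2 * deg x₀ j
    I⁺⊆I : ∀ {i} → i ∈ filter heavyI? I → i ∈ I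
    I⁺⊆I i∈ = proj₁ (∈-filter⁻ heavyI? {xs = I} i∈)
    J⁺⊆J : ∀ {j} → j ∈ filter heavyJ? J → j ∈ J
    J⁺⊆J j∈ = proj₁ (∈-filter⁻ heavyJ? {xs = J} j∈)
    heavy : ∀ {s x} J → s + q * (2 * q) < 2 * length J → Star s J x →
            2 * q < length (filter (λ j → N ≤? 2 * deg x j) J)
    heavy {s} {x} J l (mkStar h) = subst (2 * q <_) (sym (length-filter≡count _ J))
      (many-heavy J (λ j → 2 * deg x j) {q} {s} 0<N (λ j → *-monoʳ-≤ 2 (deg≤N x j))
        (subst (λ d → (q + 2) * N * length J ≤ d + s * N) (trans (lemma q (degs J x)) (cong (q *_) (sym (∑-*ˡ 2 J (deg x))))) h) l)
      where
      lemma : ∀ q d → 2 * q * d ≡ q * (2 * d)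
      lemma = solve-∀
    both-large : ∀ {m n} → 2 * q < m → 2 * q < n → q * (n + m) < n * m
    both-large {m} {n} qm qn = *-cancelˡ-< 2 _ _ (begin-strict
      2 * (q * (n + m))        ≡⟨ lemma₁ q n m ⟩
      2 * q * m + n * (2 * q)  <⟨ +-mono-< (*-monoˡ-< m {{ℕ.>-nonZero (≤-trans (s≤s z≤n) qm)}} qn)
                                                    (*-monoʳ-< n {{ℕ.>-nonZero (≤-trans (s≤s z≤n) qn)}} qm) ⟩
      n * m + n * m  ≡⟨ lemma₂ (n * m) ⟩
      2 * (n * m)    ∎)
      where
      open ≤-Reasoning
      lemma₁ : ∀ q n m → 2 * (q * (n + m)) ≡ 2 * q * m + n * (2 * q)
      lemma₁ = solve-∀
      lemma₂ : ∀ k → k + k ≡ 2 * k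
      lemma₂ = solve-∀


  -- The hub and the zigzag through it

  zigzag : ∀ {x₀ t pt} A (Bs : List (P × X)) → length Bs ≡ suc (length A) →
           All (λ (j , y) → y ∈ L j) Bs → All (λ i → ∃[ x ] x ∈ L i × All (λ (_ , y) → E x y) Bs) A →
           All (λ (_ , y) → E x₀ y) Bs → All (λ (_ , y) → E t y) Bs → t ∈ L pt →
           ∃[ ps ] Trail x₀ ps t × ps ↭ A ++ map proj₁ Bs ++ [ pt ]
  zigzag [] ((j , y) ∷ []) _ (y∈ ∷ []) [] (x₀y ∷ []) (ty ∷ []) t∈ =
    _ , ((x₀y , y∈) ∷ (E-sym ty , t∈) ∷ []) , ↭-refl
  -- Every vertex met so far or still to come on the side of `A` is joined to all of `Bs`, so the
  -- parts can be taken in list order. Both ends lie opposite `Bs`, whence the one extra entry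
  -- there.
  zigzag {pt = pt} (i ∷ A) ((j , y) ∷ Bs) l (y∈ ∷ ys∈) ((x , x∈ , xy ∷ xBs) ∷ cA) (x₀y ∷ _) (_ ∷ tBs) t∈ =
    let ps , tr , p = zigzag A Bs (suc-injective l) ys∈ (All.map (λ (x , x∈ , c) → x , x∈ , All.tail c) cA) xBs tBs t∈
    in  _ , ((x₀y , y∈) ∷ (E-sym xy , x∈) ∷ tr) ,
        ↭-trans (prep j (prep i p))
          (solve 5 (λ j i A B t → j ⊕ i ⊕ A ⊕ B ⊕ t ⊜ (i ⊕ A) ⊕ (j ⊕ B) ⊕ t) ↭-refl [ j ] [ i ] A (map proj₁ Bs) [ pt ])

  -- Entries are parts with the vertices chosen in them. The stars are relative to all of `Ws`,
  -- since they are chosen before it is known which of these parts join the hub.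
  Hub : ℕ → ℕ → List P → List P → Set
  Hub a b Vs Ws =
    ∃[ As ] ∃[ Bs ] ∃[ V′ ] ∃[ W′ ]
      Vs ↭ map proj₁ As ++ V′ × Ws ↭ map proj₁ Bs ++ W′ × length As ≡ a × length Bs ≡ b ×
      All (λ (i , x) → x ∈ L i × Star 0 Ws x × All (λ (_ , y) → E x y) Bs) As ×
      All (λ (j , y) → y ∈ L j) Bs

  regroup : ∀ {zs : List (P × X)} xs ys {ws} us → zs ↭ (xs ++ ys) ++ ws →
            map proj₁ zs ++ us ↭ map proj₁ xs ++ map proj₁ (ys ++ ws) ++ us
  regroup xs ys {ws} us p = ↭-trans (++⁺ʳ us (map⁺ proj₁ p)) (↭-reflexive
    (trans (cong (λ l → map proj₁ l ++ us) (++-assoc xs ys ws))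
      (trans (cong (_++ us) (map-++ proj₁ xs (ys ++ ws))) (++-assoc (map proj₁ xs) _ us))))

  -- This is `many-heavy` for the total degree of the `a + a` stars into a part, whose maximum is
  -- `2 * (a * N)`.
  many-heavy-parts : ∀ {a k} (D : List (P × X)) Ws → length D ≡ a + a → 0 < a →
                     All (λ (_ , x) → Star 0 Ws x) D → q * k < 2 * length Ws →
                     k < count (λ j → a * N ≤? ∑ D (λ (_ , x) → deg x j)) Ws
  many-heavy-parts {a} {k} D Ws lD 0<a stars l =
    many-heavy Ws _ {q} {0} {k} {a * N} (*-mono-≤ 0<a 0<N) (λ j → at-most j) total l
    where
    open ≤-Reasoning
    at-most : ∀ j → ∑ D (λ (_ , x) → deg x j) ≤ 2 * (a * N)
    at-most j = begin
      ∑ D (λ (_ , x) → deg x j)  ≤⟨ ∑-≤ D (λ {d} _ → deg≤N (proj₂ d) j) ⟩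
      length D * N               ≡⟨ cong (_* N) lD ⟩
      (a + a) * N                ≡⟨ lemma a N ⟩
      2 * (a * N)                ∎
      where
      lemma : ∀ a n → (a + a) * n ≡ 2 * (a * n)
      lemma = solve-∀
    lemma₁ : ∀ a q n l → 2 * ((q + 2) * (a * n) * l) ≡ (a + a) * ((q + 2) * n * l)
    lemma₁ = solve-∀
    lemma₂ : ∀ q m d → 2 * q * d ≡ 2 * (q * d + 0 * m)
    lemma₂ = solve-∀
    total : (q + 2) * (a * N) * length Ws ≤ q * ∑[ j ∈ Ws ] ∑ D (λ (_ , x) → deg x j) + 0 * (a * N)
    total = *-cancelˡ-≤ 2 (begin
      2 * ((q + 2) * (a * N) * length Ws)            ≡⟨ lemma₁ a q N (length Ws) ⟩
      (a + a) * ((q + 2) * N * length Ws)            ≡⟨ cong (_* _) lD ⟨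
      length D * ((q + 2) * N * length Ws)           ≤⟨ ∑-≥ D (λ d∈ → ≤-trans (large (All.lookup stars d∈)) (≤-reflexive (+-identityʳ _))) ⟩
      ∑ D (λ (_ , x) → 2 * q * degs Ws x)            ≡⟨ ∑-*ˡ (2 * q) D _ ⟩
      2 * q * ∑ D (λ (_ , x) → degs Ws x)            ≡⟨ cong (2 * q *_) (∑-swap D Ws _) ⟩
      2 * q * ∑[ j ∈ Ws ] ∑ D (λ (_ , x) → deg x j)  ≡⟨ lemma₂ q (a * N) _ ⟩
      2 * (q * ∑[ j ∈ Ws ] ∑ D (λ (_ , x) → deg x j) + 0 * (a * N)) ∎)

  -- Double counting the edges between `D` and `L j`, then averaging over the `N` entries of `L j`.
  heavy-vertex : ∀ {a j} (D : List (P × X)) → a * N ≤ ∑ D (λ (_ , x) → deg x j) →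
                 ∃[ y ] y ∈ L j × a ≤ count (λ (_ , x) → E? x y) D
  heavy-vertex {a} {j} D h = ∑-average (L j) (subst (0 <_) (sym (∣L∣ j)) 0<N)
    (subst₂ _≤_ (trans (*-comm a N) (cong (_* a) (sym (∣L∣ j)))) (∑-swap D (L j) (λ (_ , x) y → 𝟙 (E? x y))) h)

  -- Among a + a stars, each of many parts j has a vertex adjacent to half of them; by
  -- pigeonhole many of these vertices have the same neighbours.
  hub : ∀ {a b c Vs Ws} → On c Vs → On (not c) Ws → 0 < a → 0 < b →
        a + a ≤ length Vs → q * (b * 2 ^ (a + a)) < 2 * length Ws → Hub a b Vs Ws
  hub {a} {b} {c} {Vs} {Ws} oV oW 0<a 0<b aa≤ big
    with split-length (a + a) {Vs} aa≤
  ... | D₀ , V₁ , refl , lD₀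
    with choose D₀ (All.map (λ si → star (opposite si oW)) (++⁻ˡ D₀ oV))
  ... | D , refl , stars
    with split (λ j → a * N ≤? ∑ D (λ (_ , x) → deg x j)) Ws
       | many-heavy-parts {a} D Ws (trans (sym (length-map proj₁ D)) lD₀) 0<a (All.map proj₂ stars) big
  ... | G , W₁ , pG , heavies , _ , lG | many
    with choose G (All.map (heavy-vertex D) heavies)
  ... | Ys , refl , ys
    with homogeneous (λ (_ , x) (_ , y) → E? x y) D Ys {b}
           (subst₂ (λ d l → b * 2 ^ d ≤ l) (trans (sym lD₀) (length-map proj₁ D))
                   (trans (sym lG) (length-map proj₁ Ys)) (<⇒≤ many))
  ... | Y₁ , Y₂ , pY , b≤ , hom
    with split-length b {Y₁} b≤
  ... | Bs , Y₃ , refl , lB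
    with split (λ (_ , x) → all? (λ (_ , y) → E? x y) (Bs ++ Y₃)) D
       | inhabited Bs (subst (0 <_) (sym lB) 0<b)
  ... | D⁺ , D⁻ , pD , complete , _ , lD⁺ | (j , y) , y∈
    -- One vertex `y` of the homogeneous list already has `a` neighbours among the stars, and each
    -- of these is then joined to the whole list.
    with split-length a {D⁺} (begin
           a                             ≤⟨ proj₂ (All.lookup (All-resp-↭ pY ys) (∈-++⁺ˡ (∈-++⁺ˡ y∈))) ⟩
           count (λ (_ , x) → E? x y) D  ≤⟨ complete-count (λ (_ , x) (_ , y) → E? x y) D (∈-++⁺ˡ y∈) hom ⟩
           _                             ≡⟨ lD⁺ ⟨
           length D⁺                     ∎)
    where open ≤-Reasoning
  ... | As , D₂ , refl , lA =
    As , Bs , map proj₁ (D₂ ++ D⁻) ++ V₁ , map proj₁ (Y₃ ++ Y₂) ++ W₁ ,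
    regroup As D₂ V₁ pD , ↭-trans pG (regroup Bs Y₃ W₁ pY) , lA , lB ,
    All.zipWith (λ ((x∈ , st) , c) → x∈ , st , ++⁻ˡ Bs c)
      (++⁻ˡ As (++⁻ˡ (As ++ D₂) (All-resp-↭ pD stars)) , ++⁻ˡ As complete) ,
    ++⁻ˡ Bs (++⁻ˡ (Bs ++ Y₃) (All.map proj₁ (All-resp-↭ pY ys)))

  -- Assembling the closed trail

  Woven : List P → P → List P → X → P → X → Set
  Woven A j₂ W v j₁ w₁ =
    ∃[ Aᵤ ] ∃[ A′ ] ∃[ ps ] A ↭ Aᵤ ++ A′ × length Aᵤ ≡ suc (length W) ×
      Trail v ps w₁ × ps ↭ (j₂ ∷ W) ++ Aᵤ ++ [ j₁ ]

  ChainedTo : List P → List P → X → P → X → Set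
  ChainedTo I J x pt t =
    ∃[ U ] ∃[ J′ ] ∃[ ps ] J ↭ U ++ J′ × length U ≡ suc (length I) × Trail x ps t × ps ↭ U ++ (pt ∷ I)

  -- v ⇝ w₂ by a bridge, then w₂ ⇝ w₁ by a chain through all that is left of W.
  weave : ∀ {c A j₂ W v w₁ j₁} → Unique A → Unique W → On c A → On (not c) (j₂ ∷ W) → w₁ ∈ L j₁ →
          Star (2 * q) (j₂ ∷ W) v → Star (4 * q) A w₁ →
          reserve q ≤ suc (length W) → length W ≤ reserve q + 1 → hubW q + length W ≤ length A → reserve q ≤ length A →
          Woven A j₂ W v j₁ w₁
  weave {c} {A} {j₂} {W} {v} {w₁} {j₁} A! W! oA (oj₂ ∷ oW) w₁∈ stv stw₁ K≤W W≤K b≤A K≤A =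
    step₁ (star {j₂} {A} (opposite oj₂ oA′))
    where
    oA′ : On (not (not c)) A
    oA′ = subst (λ d → On d A) (sym (not-involutive c)) oA

    step₁ : ∃[ w₂ ] w₂ ∈ L j₂ × Star 0 A w₂ → Woven A j₂ W v j₁ w₁
    step₁ (w₂ , w₂∈ , stw₂) =
      step₂ (bridge A! W! oA oW w₂∈ (Star-drop [ j₂ ] stv) (star-size q K≤W) stw₂ (reserve-size q K≤A))
      where
      step₂ : Joined A W v j₂ w₂ → Woven A j₂ W v j₁ w₁
      step₂ (Aᵥ , Wᵥ , A₂ , W₅ , ps₃ , p₄ , p₅ , v≡ , v≤ , tr₃ , q₃) =
        step₃ (chain-to W₅ (++⁻ʳ Wᵥ (All-resp-↭ p₅ oW)) (++⁻ʳ Aᵥ (All-resp-↭ p₄ oA′)) w₁∈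
                 st₂ (*-monoˡ-≤ q {2} {4} (s≤s (s≤s z≤n))) st₁ enough)
        where
        l₄ : length A ≡ length Aᵥ + length A₂
        l₄ = length-↭-++ Aᵥ p₄
        l₅ : length W ≡ length Wᵥ + length W₅
        l₅ = length-↭-++ Wᵥ p₅
        -- A bridge removes at most two parts of `A`, an error of at most `4 * q`. For `w₁`, which
        -- already carries `4 * q` from the earlier bridge, this makes `8 * q`.
        st₂ : Star (4 * q) A₂ w₂
        st₂ = Star-weaken (slack-size q v≤ v≡) (Star-drop Aᵥ (Star-↭ p₄ stw₂))
        st₁ : Star (8 * q) A₂ w₁
        st₁ = Star-weaken (≤-trans (+-monoʳ-≤ (4 * q) (slack-size q v≤ v≡)) (≤-reflexive (sym (*-distribʳ-+ q 4 4))))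
                (Star-drop Aᵥ (Star-↭ p₄ stw₁))
        enough : 4 * q + 8 * q + (2 * q + 4) * length W₅ < 4 * length A₂
        enough = chain-size q {length W₅} {length A₂} (≤-trans (m≤n+m _ (length Wᵥ)) (≤-trans (≤-reflexive (sym l₅)) W≤K))
                   (remaining-size b≤A l₅ l₄ v≡)
        step₃ : ChainedTo W₅ A₂ w₂ j₁ w₁ → Woven A j₂ W v j₁ w₁
        step₃ (X , A₃ , ps₄ , p₆ , lX , tr₄ , q₄) =
          Aᵥ ++ X , A₃ , ps₃ ++ ps₄ ,
          ↭-trans p₄ (↭-trans (++⁺ˡ Aᵥ p₆) (↭-reflexive (sym (++-assoc Aᵥ X A₃)))) ,
          trans (length-++ Aᵥ) (trans (cong₂ _+_ v≡ lX) (trans (+-suc (length Wᵥ) _) (cong suc (sym l₅)))) ,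
          tr₃ ++ᵗ tr₄ ,
          ↭-trans (++⁺ q₃ q₄) (↭-trans
            (solve 6 (λ Wᵥ Aᵥ j₂ X j₁ W₅ → (Wᵥ ⊕ Aᵥ ⊕ j₂) ⊕ X ⊕ j₁ ⊕ W₅ ⊜ (j₂ ⊕ Wᵥ ⊕ W₅) ⊕ (Aᵥ ⊕ X) ⊕ j₁)
              ↭-refl Wᵥ Aᵥ [ j₂ ] X [ j₁ ] W₅)
            (++⁺ʳ ((Aᵥ ++ X) ++ [ j₁ ]) (prep j₂ (↭-sym p₅))))

  Chained : List P → List P → X → Set
  Chained V J x = ∃[ U ] ∃[ J′ ] ∃[ v ] ∃[ ps ]
    J ↭ U ++ J′ × length U ≡ length V × Trail x ps v × ps ↭ U ++ V × Star (2 * q) J′ v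

  Routed : List P → List P → List P → P → X → X → Set
  Routed A V W i₁ x₂ x₁ = ∃[ Aᵤ ] ∃[ A′ ] ∃[ ps ]
    A ↭ Aᵤ ++ A′ × length Aᵤ ≡ reserve q + 2 × Trail x₂ ps x₁ × ps ↭ V ++ W ++ Aᵤ ++ [ i₁ ]

  -- The trail consists of a chain from `x₂` through all of `V`, the weave that uses up `W` and ends
  -- at a star `w₁` of part `j₁`, and a bridge from `w₁` to `x₁`. The bridge is constructed first,
  -- while `W` is still large; the chain and the weave then work with what it leaves.
  route : ∀ {c A V W i₁ x₁ x₂} → Unique A → Unique W → On c A → On c V → On (not c) W →
          x₁ ∈ L i₁ → Star (2 * q * hubW q) W x₁ → Star (2 * q * hubW q) W x₂ →
          length A ≡ hubW q + reserve q + 1 → length W ≡ length V + (reserve q + 3) → margin q < length V →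
          Routed A V W i₁ x₂ x₁
  route {c} {A} {i ∷ V} {j₁ ∷ W} {i₁} {x₁} {x₂} A! W! oA oV (oj₁ ∷ oW) x₁∈ st₁ st₂ lA lW big =
    step₁ (star {j₁} {A} (opposite oj₁ oA′))
    where
    oA′ : On (not (not c)) A
    oA′ = subst (λ d → On d A) (sym (not-involutive c)) oA
    W₁! : Unique W
    W₁! = Unique-++⁻ʳ [ j₁ ] W!
    lW₁ : length W ≡ length (i ∷ V) + (reserve q + 2)
    lW₁ = route-size {v = length (i ∷ V)} {reserve q} lW

    step₁ : ∃[ w₁ ] w₁ ∈ L j₁ × Star 0 A w₁ → Routed A (i ∷ V) (j₁ ∷ W) i₁ x₂ x₁
    step₁ (w₁ , w₁∈ , stw₁) =
      step₂ (bridge W₁! A! oW oA′ x₁∈ stw₁ (reserve-size q (hub-size q lA)) (Star-drop [ j₁ ] st₁) (margin-size q big lW₁))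
      where
      step₂ : Joined W A w₁ i₁ x₁ → Routed A (i ∷ V) (j₁ ∷ W) i₁ x₂ x₁
      step₂ (Wᵤ , Aᵤ , W₂ , A₁ , ps₁ , p₁ , p₂ , u≡ , u≤ , tr₁ , q₁) =
        step₃ (chain V oV (++⁻ʳ Wᵤ (All-resp-↭ p₁ oW)) (Star-drop Wᵤ (Star-↭ p₁ (Star-drop [ j₁ ] st₂)))
                 (margin-size′ q big lW₁ l₁ u≡ u≤) (chain-room q lW₁ l₁ u≡ u≤))
        where
        l₁ : length W ≡ length Wᵤ + length W₂
        l₁ = length-↭-++ Wᵤ p₁
        l₂ : length A ≡ length Aᵤ + length A₁
        l₂ = length-↭-++ Aᵤ p₂
        step₃ : Chained (i ∷ V) W₂ x₂ → Routed A (i ∷ V) (j₁ ∷ W) i₁ x₂ x₁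
        -- The surplus of `reserve q + 2` parts in `W` cannot be exhausted by a bridge that takes at
        -- most two.
        step₃ (U , [] , v , ps₂ , p₃ , lU , tr₂ , q₂ , stv) = ⊥-elim (not-empty q lW₁ l₁ (length-↭-++ U p₃) lU u≡ u≤)
        step₃ (U , j₂ ∷ W₄ , v , ps₂ , p₃ , lU , tr₂ , q₂ , stv) =
          step₄ (weave (Unique-++⁻ʳ Aᵤ (Unique-↭ p₂ A!))
                       (Unique-++⁻ʳ (U ++ [ j₂ ]) (subst Unique (sym (++-assoc U [ j₂ ] W₄)) (Unique-↭ p₃ (Unique-++⁻ʳ Wᵤ (Unique-↭ p₁ W₁!)))))
                       (++⁻ʳ Aᵤ (All-resp-↭ p₂ oA)) (++⁻ʳ U (All-resp-↭ p₃ (++⁻ʳ Wᵤ (All-resp-↭ p₁ oW))))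
                       w₁∈ stv (Star-weaken (slack-size q u≤ refl) (Star-drop Aᵤ (Star-↭ p₂ stw₁)))
                       (reserve-left q l₄ u≤) (reserve-right q l₄) (hub-left q l₄ lA l₂) (hub-left′ q lA l₂ u≤))
          where
          l₄ : length Aᵤ + suc (length W₄) ≡ reserve q + 2
          l₄ = left-size lW₁ l₁ (length-↭-++ U p₃) lU u≡
          step₄ : Woven A₁ j₂ W₄ v j₁ w₁ → Routed A (i ∷ V) (j₁ ∷ W) i₁ x₂ x₁
          step₄ (Aᵥ , A₂ , ps₃ , p₄ , lAᵥ , tr₃ , q₃) =
            Aᵤ ++ Aᵥ , A₂ , ps₂ ++ ps₃ ++ ps₁ ,
            ↭-trans p₂ (↭-trans (++⁺ˡ Aᵤ p₄) (↭-reflexive (sym (++-assoc Aᵤ Aᵥ A₂)))) ,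
            trans (length-++ Aᵤ) (trans (cong (length Aᵤ +_) lAᵥ) l₄) ,
            tr₂ ++ᵗ (tr₃ ++ᵗ tr₁) ,
            ↭-trans (++⁺ q₂ (++⁺ q₃ q₁)) (↭-trans
              (solve 9 (λ U V j₂ W₄ Aᵥ j₁ Aᵤ Wᵤ i₁ →
                 (U ⊕ V) ⊕ ((j₂ ⊕ W₄) ⊕ Aᵥ ⊕ j₁) ⊕ (Aᵤ ⊕ Wᵤ ⊕ i₁) ⊜
                 V ⊕ (j₁ ⊕ (Wᵤ ⊕ (U ⊕ (j₂ ⊕ W₄)))) ⊕ (Aᵤ ⊕ Aᵥ) ⊕ i₁)
                 ↭-refl U (i ∷ V) [ j₂ ] W₄ Aᵥ [ j₁ ] Aᵤ Wᵤ [ i₁ ])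
              (++⁺ˡ (i ∷ V) (++⁺ʳ ((Aᵤ ++ Aᵥ) ++ [ i₁ ]) (prep j₁ (↭-sym (↭-trans p₁ (++⁺ˡ Wᵤ p₃)))))))

  Closed : List P → Set
  Closed ps = ∃[ x ] ∃[ qs ] Trail x qs x × qs ↭ ps

  closed-trail : ∀ {c Vs Ws} → Unique Vs → Unique Ws → On c Vs → On (not c) Ws →
                 length Vs ≡ length Ws → threshold q ≤ length Vs → Closed (Vs ++ Ws)
  closed-trail {c} {Vs} {Ws} V! W! oV oW same big =
    step₁ (hub oV oW (s≤s z≤n) (m≤n+m 1 _) (hub-fits q big) (hub-dense q (subst (threshold q ≤_) same big)))
    where
    step₁ : Hub (hubV q) (hubW q) Vs Ws → Closed (Vs ++ Ws)
    step₁ ((i₁ , x₁) ∷ (i₂ , x₂) ∷ As , Bs , V′ , W′ , pV , pW , lA , lB ,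
           (x₁∈ , st₁ , x₁Bs) ∷ (x₂∈ , st₂ , x₂Bs) ∷ hubs , ys∈) =
      -- Two stars of the hub are set aside: the route leads from `x₂` to `x₁`, and the zigzag leads
      -- from `x₁` back to `x₂`.
      step₂ (route A₀! (Unique-++⁻ʳ B₀ (Unique-↭ pW W!)) (++⁻ˡ A₀ oAV) (++⁻ʳ A₀ oAV) (++⁻ʳ B₀ (All-resp-↭ pW oW))
                   x₁∈ (rest st₁) (rest st₂) lA′ (outside-size q lV lW) (margin-fits q big lV))
      where
      A₀ = map proj₁ As
      B₀ = map proj₁ Bs
      A₀! : Unique A₀
      A₀! = Unique-++⁻ˡ A₀ (Unique-++⁻ʳ (i₁ ∷ i₂ ∷ []) (Unique-↭ pV V!))
      oAV : On c (A₀ ++ V′)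
      oAV = ++⁻ʳ (i₁ ∷ i₂ ∷ []) (All-resp-↭ pV oV)
      lB′ : length B₀ ≡ hubW q
      lB′ = trans (length-map proj₁ Bs) lB
      lA′ : length A₀ ≡ hubW q + reserve q + 1
      lA′ = trans (length-map proj₁ As) (suc-injective (suc-injective lA))
      lV : length Vs ≡ hubV q + length V′
      lV = trans (length-↭-++ (i₁ ∷ i₂ ∷ A₀) pV) (cong (λ n → suc (suc n) + length V′) lA′)
      lW : length Vs ≡ hubW q + length W′
      lW = trans same (trans (length-↭-++ B₀ pW) (cong (_+ length W′) lB′))
      rest : ∀ {x} → Star 0 Ws x → Star (2 * q * hubW q) W′ x
      rest st = subst (λ n → Star (2 * q * n) W′ _) lB′ (Star-drop B₀ (Star-↭ pW st))

      step₂ : Routed A₀ V′ W′ i₁ x₂ x₁ → Closed (Vs ++ Ws)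
      step₂ (Aᵤ , A′ , ps , p , lU , tr , q₁) =
        step₃ (zigzag A′ Bs (trans lB (zigzag-size q lA′ (length-↭-++ Aᵤ p) lU)) ys∈
                (++⁻ʳ Aᵤ (All-resp-↭ p (All-map⁺ (All.map (λ (x∈ , _ , c) → _ , x∈ , c) hubs)))) x₁Bs x₂Bs x₂∈)
        where
        step₃ : ∃[ ps′ ] Trail x₁ ps′ x₂ × ps′ ↭ A′ ++ B₀ ++ [ i₂ ] → Closed (Vs ++ Ws)
        step₃ (ps′ , tr′ , q₂) = x₂ , ps ++ ps′ , tr ++ᵗ tr′ ,
          ↭-trans (++⁺ q₁ q₂) (↭-trans
            (solve 7 (λ V′ W′ Aᵤ i₁ A′ B₀ i₂ → (V′ ⊕ W′ ⊕ Aᵤ ⊕ i₁) ⊕ (A′ ⊕ B₀ ⊕ i₂) ⊜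
                                              (i₁ ⊕ i₂ ⊕ (Aᵤ ⊕ A′) ⊕ V′) ⊕ (B₀ ⊕ W′))
              ↭-refl V′ W′ Aᵤ [ i₁ ] A′ B₀ [ i₂ ])
            (↭-sym (++⁺ (↭-trans pV (prep i₁ (prep i₂ (++⁺ʳ V′ p)))) pW)))

  -- Reading a closed trail as a cyclic sequence of vertices

  at : ∀ {x ps z} → Trail x ps z → Fin (length ps) → X
  at (_∷_ {y = y} _ t) zero    = y
  at (_ ∷ t)           (suc k) = at t k

  at∈ : ∀ {x ps z} (t : Trail x ps z) k → at t k ∈ L (lookup ps k)
  at∈ ((_ , y∈) ∷ t) zero    = y∈
  at∈ (_ ∷ t)        (suc k) = at∈ t k

  at-first : ∀ {x ps z} (t : Trail x ps z) k → toℕ k ≡ 0 → E x (at t k)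
  at-first ((xy , _) ∷ t) zero _ = xy

  at-next : ∀ {x ps z} (t : Trail x ps z) i j → suc (toℕ i) ≡ toℕ j → E (at t i) (at t j)
  at-next (_ ∷ t) zero    (suc j) eq = at-first t j (suc-injective (sym eq))
  at-next (_ ∷ t) (suc i) (suc j) eq = at-next t i j (suc-injective eq)

  at-last : ∀ {x ps z} (t : Trail x ps z) i → suc (toℕ i) ≡ length ps → at t i ≡ z
  at-last (_ ∷ [])    zero    _  = refl
  at-last (_ ∷ t@(_ ∷ _)) (suc i) eq = at-last t i (suc-injective eq)

  -- A trail does not list its starting vertex, so in a closed trail the last vertex listed is `x`,
  -- which is adjacent to the first. This is the edge needed where `next` wraps around.
  at-cyclic : ∀ {x ps} (t : Trail x ps x) i j → next i ≡ toℕ j → E (at t i) (at t j)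
  at-cyclic {x} {ps} t i j eq with suc (toℕ i) <? length ps
  ... | yes i< = at-next t i j (trans (sym (m<n⇒m%n≡m {{Finₚ.nonZeroIndex i}} i<)) eq)
  ... | no  i≮ = subst (λ y → E y (at t j)) (sym (at-last t i last))
                   (at-first t j (trans (sym eq) (trans (cong (_% length ps) last) (n%n≡0 (length ps)))))
    where
    instance _ = Finₚ.nonZeroIndex i
    last : suc (toℕ i) ≡ length ps
    last = ≤-antisym (Finₚ.toℕ<n i) (≮⇒≥ i≮)

-- Traversals

unique-lookup : ∀ {A : Set} {xs : List A} → Unique xs → ∀ i j → lookup xs i ≡ lookup xs j → i ≡ j
unique-lookup (_  ∷ _) zero    zero    _  = refl
unique-lookup (x∉ ∷ _) zero    (suc j) eq = ⊥-elim (All.lookup x∉ (∈-lookup j) eq)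
unique-lookup (x∉ ∷ _) (suc i) zero    eq = ⊥-elim (All.lookup x∉ (∈-lookup i) (sym eq))
unique-lookup (_  ∷ u) (suc i) (suc j) eq = cong suc (unique-lookup u i j eq)

module _ {n} {Q : Fin n → Set} (Q? : Decidable₁ Q) where

  subset : Subset n
  subset = Vec.tabulate (λ v → does (Q? v))

  ∈-subset⁺ : ∀ {v} → Q v → v ∈ˢ subset
  ∈-subset⁺ {v} qv = lookup⇒[]= v subset (trans (lookup∘tabulate _ v) (dec-true (Q? v) qv))

  ∈-subset⁻ : ∀ {v} → v ∈ˢ subset → Q v
  ∈-subset⁻ {v} v∈ with Q? v | trans (sym (lookup∘tabulate (λ v → does (Q? v)) v)) ([]=⇒lookup v∈)
  ... | yes qv | _ = qv

induced : ∀ {n} (G : Graph n) {Q : Fin n → Set} → Decidable₁ Q → Subgraph G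
induced G Q? = record
  { vertices = subset Q?
  ; SubAdj   = λ u v → (u ∈ˢ subset Q? × v ∈ˢ subset Q?) × Graph.Adj G u v
  ; subAdj?  = λ u v → ((u ∈? subset Q?) ×-dec (v ∈? subset Q?)) ×-dec Graph.adj? G u v
  ; sub-sym  = λ ((u∈ , v∈) , uv) → (v∈ , u∈) , Graph.sym G uv
  ; ends     = proj₁
  ; sub⊆     = proj₂
  }

-- The traversal is induced on the image of `f`. Parts are disjoint and `ps` lists each of them
-- once, so `f` is injective and meets every part in exactly one vertex.
cycle-traversal : ∀ {m n} {H : Graph m} (G : Partite H n) (ps : List (Fin m)) (f : Fin (length ps) → Fin n) →
                  Unique ps → (∀ i → i ∈ ps) → (∀ k → f k ∈ˢ Partite.part G (lookup ps k)) →
                  (∀ i j → next i ≡ toℕ j → Graph.Adj (Partite.graph G) (f i) (f j)) →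
                  HasTraversal G (C (length ps))
cycle-traversal {n = n} G ps f ps! all f∈ adj =
  induced (Partite.graph G) image? , traversal , f , injective , (λ k → ∈-subset⁺ image? (k , refl)) , edge
  where
  open Partite G
  image? : Decidable₁ (λ v → ∃[ k ] f k ≡ v)
  image? v = Finₚ.any? (λ k → f k Finₚ.≟ v)
  same-part : ∀ {v i j} → v ∈ˢ part i → v ∈ˢ part j → i ≡ j
  same-part {v} v∈i v∈j with partition v
  ... | _ , _ , unique = trans (sym (unique v∈i)) (unique v∈j)
  injective : Injective _≡_ _≡_ f
  injective {i} {j} eq = unique-lookup ps! i j (same-part (f∈ i) (subst (_∈ˢ part (lookup ps j)) (sym eq) (f∈ j)))
  traversal : IsTraversal G (induced graph image?)
  traversal i = f k , (fk∈ , ∈-subset⁺ image? (k , refl)) , λ (v∈ , v∈T) → determined v∈ (∈-subset⁻ image? v∈T)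
    where
    k = index (all i)
    fk∈ : f k ∈ˢ part i
    fk∈ = subst (λ p → f k ∈ˢ part p) (sym (lookup-index (all i))) (f∈ k)
    determined : ∀ {v} → v ∈ˢ part i → ∃[ k ] f k ≡ v → f (index (all i)) ≡ v
    determined v∈ (l , refl) = cong f (unique-lookup ps! k l (same-part (f∈ k) (subst (λ p → f k ∈ˢ part p) (same-part v∈ (f∈ l)) fk∈)))
  edge : ∀ {i j} → Graph.Adj (C (length ps)) i j → Subgraph.SubAdj (induced graph image?) (f i) (f j)
  edge {i} {j} (_ , eq) = (∈-subset⁺ image? (i , refl) , ∈-subset⁺ image? (j , refl)) , step eq
    where
    step : next i ≡ toℕ j ⊎ next j ≡ toℕ i → Graph.Adj graph (f i) (f j)
    step (inj₁ e) = adj i j e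
    step (inj₂ e) = Graph.sym graph (adj j i e)

-- Traversals of dense `K r r`-partite graphs and the critical density

m∣n! : ∀ {m n} → 0 < m → m ≤ n → m ∣ n !
m∣n! {suc m} _ m≤n = ∣-trans (m∣m*n (m !)) (m≤n⇒m!∣n! m≤n)

on-sides : ∀ r → All (λ i → does (toℕ i <? r) ≡ true)  (map (_↑ˡ r) (allFin r))
               × All (λ i → does (toℕ i <? r) ≡ false) (map (r ↑ʳ_) (allFin r))
on-sides r =
  All-map⁺ (All.universal (λ i → dec-true (toℕ (i ↑ˡ r) <? r) (subst (_< r) (sym (Finₚ.toℕ-↑ˡ i r)) (Finₚ.toℕ<n i))) (allFin r)) ,
  All-map⁺ (All.universal (λ i → dec-false (toℕ (r ↑ʳ i) <? r)
    (λ lt → <⇒≱ lt (subst (r ≤_) (sym (Finₚ.toℕ-↑ʳ r i)) (m≤m+n r (toℕ i))))) (allFin r))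

hamiltonian-traversal : ∀ {n} r q → threshold q ≤ r → (G : Partite (K r r) n) →
  (let open Partite G in ∀ i j → toℕ i < r → r ≤ toℕ j →
    (q + 2) * (∣ part i ∣ * ∣ part j ∣) ≤ e graph (part i) (part j) * (2 * q)) →
  HasTraversal G (C (2 * r))
hamiltonian-traversal {n} r q big G dense = subst (λ k → HasTraversal G (C k)) lps traversal
  where
  open Partite G

  -- Vertices are repeated so that all parts have n ! entries and densities become counts.
  divides-n! : ∀ i → ∣ part i ∣ ∣ n !
  divides-n! i = m∣n! (ℕ.>-nonZero⁻¹ _ {{card-nonZero (nonempty i)}}) (∣p∣≤n (part i))

  copies : Fin (r + r) → ℕ
  copies i = quotient (divides-n! i)

  copies-size : ∀ i → copies i * ∣ part i ∣ ≡ n !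
  copies-size i = sym (_∣_.equality (divides-n! i))

  L : Fin (r + r) → List (Fin n)
  L i = repeat (copies i) (elements (part i))

  ∣L∣ : ∀ i → length (L i) ≡ n !
  ∣L∣ i = trans (length-repeat (copies i) (elements (part i)))
            (trans (cong (copies i *_) (length-elements (part i))) (copies-size i))

  L⊆part : ∀ i {v} → v ∈ L i → v ∈ˢ part i
  L⊆part i v∈ = proj₂ (∈-filter⁻ (_∈? part i) {xs = allFin n} (∈-repeat⁻ (copies i) v∈))

  side : Fin (r + r) → Bool
  side i = does (toℕ i <? r)

  denseL : ∀ {i j} → side i ≢ side j →
           (q + 2) * (n ! * n !) ≤ 2 * q * ∑[ x ∈ L i ] count (Graph.adj? graph x) (L j)
  denseL {i} {j} = go (toℕ i <? r) (toℕ j <? r)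
    where
    forward : ∀ i j → toℕ i < r → r ≤ toℕ j →
              (q + 2) * (n ! * n !) ≤ 2 * q * ∑[ x ∈ L i ] count (Graph.adj? graph x) (L j)
    forward i j i<r r≤j = repeat-dense graph (part i) (part j) (copies i) (copies j) q
      (copies-size i) (copies-size j) (dense i j i<r r≤j)
    go : (d : Dec (toℕ i < r)) (d′ : Dec (toℕ j < r)) → does d ≢ does d′ →
         (q + 2) * (n ! * n !) ≤ 2 * q * ∑[ x ∈ L i ] count (Graph.adj? graph x) (L j)
    go (yes _)   (yes _)   ne = ⊥-elim (ne refl)
    go (no _)    (no _)    ne = ⊥-elim (ne refl)
    go (yes i<r) (no j≮r)  _  = forward i j i<r (≮⇒≥ j≮r)
    -- Densities are given only from the first side to the second; the other direction counts the
    -- same edges in the opposite order.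
    go (no i≮r)  (yes j<r) _  = ≤-trans (forward j i j<r (≮⇒≥ i≮r)) (≤-reflexive (cong (2 * q *_)
      (trans (∑-swap (L j) (L i) _) (∑-cong (L i) (λ x → ∑-cong (L j) (λ y →
        𝟙-cong (Graph.adj? graph y x) (Graph.adj? graph x y) (Graph.sym graph) (Graph.sym graph)))))))

  Vs = map (_↑ˡ r) (allFin r)
  Ws = map (r ↑ʳ_) (allFin r)

  length-side : ∀ (f : Fin r → Fin (r + r)) → length (map f (allFin r)) ≡ r
  length-side f = trans (length-map f (allFin r)) (length-tabulate (λ i → i))

  Vs! : Unique Vs
  Vs! = Uniqueₚ.map⁺ (λ {i} {j} → Finₚ.↑ˡ-injective r i j) (Uniqueₚ.allFin⁺ r)

  Ws! : Unique Ws
  Ws! = Uniqueₚ.map⁺ (λ {i} {j} → Finₚ.↑ʳ-injective r i j) (Uniqueₚ.allFin⁺ r)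

  all-parts : ∀ i → i ∈ Vs ++ Ws
  all-parts i with splitAt r i in eq
  ... | inj₁ k = subst (_∈ Vs ++ Ws) (Finₚ.splitAt⁻¹-↑ˡ eq) (∈-++⁺ˡ (∈-map⁺ (_↑ˡ r) (∈-allFin k)))
  ... | inj₂ k = subst (_∈ Vs ++ Ws) (Finₚ.splitAt⁻¹-↑ʳ eq) (∈-++⁺ʳ Vs (∈-map⁺ (r ↑ʳ_) (∈-allFin k)))

  parts! : Unique (Vs ++ Ws)
  parts! = Uniqueₚ.++⁺ Vs! Ws! (λ (v∈ , w∈) →
    case-≢ (trans (sym (All.lookup (proj₁ (on-sides r)) v∈)) (All.lookup (proj₂ (on-sides r)) w∈)))
    where
    case-≢ : ∀ {A : Set} → true ≡ false → A
    case-≢ ()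

  open Core Finₚ._≟_ (Graph.adj? graph) (Graph.sym graph) L (1≤n! n) ∣L∣ side q denseL

  cycle : Closed (Vs ++ Ws)
  cycle = closed-trail Vs! Ws! (proj₁ (on-sides r)) (proj₂ (on-sides r))
            (trans (length-side (_↑ˡ r)) (sym (length-side (r ↑ʳ_)))) (subst (threshold q ≤_) (sym (length-side (_↑ˡ r))) big)

  x = proj₁ cycle
  ps = proj₁ (proj₂ cycle)

  trail : Trail x ps x
  trail = proj₁ (proj₂ (proj₂ cycle))

  ps↭ : ps ↭ Vs ++ Ws
  ps↭ = proj₂ (proj₂ (proj₂ cycle))

  lps : length ps ≡ 2 * r
  lps = trans (↭-length ps↭) (trans (length-++ Vs) (cong₂ _+_ (length-side (_↑ˡ r))
          (trans (length-side (r ↑ʳ_)) (sym (+-identityʳ r)))))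

  traversal : HasTraversal G (C (length ps))
  traversal = cycle-traversal G ps (at trail) (Unique-↭ (↭-sym ps↭) parts!)
    (λ i → ∈-resp-↭ (↭-sym ps↭) (all-parts i)) (λ k → L⊆part (lookup ps k) (at∈ trail k)) (at-cyclic trail)

d_H≤density : ∀ {m n} {H : Graph m} (G : Partite H n) {i j} → (i , j) ∈ edges H →
  (let open Partite G in d_H G ℚ.≤ density graph (part i) (part j) (nonempty i) (nonempty j))
d_H≤density {H = H} G ij∈ = All.lookup (Extremaℚ.min≤xs 1ℚ (map _ (edges H))) (∈-map⁺ _ ij∈)

theorem1p2 : ∀ (ε : ℚ) → 0ℚ ℚ.< ε →
    ∃[ r₀ ] (∀ (r : ℕ) → r₀ ℕ.< r → π (K r r) (C (2 ℕ.* r)) <ᵘ (½ ℚ.+ ε))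
theorem1p2 ε 0<ε with half+1/q<½+ε ε 0<ε
... | q′ , u<½+ε = threshold q , λ r r₀<r → u , (λ {α} → bound r r₀<r {α}) , u<½+ε
  where
  q = suc q′
  -- The number `1/2 + 1/q` serves as the rational upper bound below `½ ℚ.+ ε` that `sup` asks for.
  u = ℤ.+ (q + 2) ℚ./ (2 * q)
  bound : ∀ r → threshold q < r → ∀ {α} → Avoidable (K r r) (C (2 * r)) α → α ℚ.≤ u
  -- If `α` exceeded `u`, every pair of opposite parts would have density above `u`, and the
  -- traversal excluded by `none` would exist.
  bound r r₀<r {α} (_ , _ , n , G , α≤d , none) = ℚₚ.≮⇒≥ λ u<α → none
    (hamiltonian-traversal r q (<⇒≤ r₀<r) G λ i j i<r r≤j → <⇒≤ (dense u<α i j i<r r≤j))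
    where
    open Partite G
    dense : u ℚ.< α → ∀ i j → toℕ i < r → r ≤ toℕ j →
            (q + 2) * (∣ part i ∣ * ∣ part j ∣) < e graph (part i) (part j) * (2 * q)
    dense u<α i j i<r r≤j = /-<⇒*-< (q + 2) (2 * q) (e graph (part i) (part j)) (∣ part i ∣ * ∣ part j ∣)
      (ℚₚ.<-≤-trans u<α (ℚₚ.≤-trans α≤d (d_H≤density G ij∈)))
      where
      instance _ = m*n≢0 ∣ part i ∣ ∣ part j ∣ {{card-nonZero (nonempty i)}} {{card-nonZero (nonempty j)}}
      ij∈ : (i , j) ∈ edges (K r r)
      ij∈ = ∈-filter⁺ _ (∈-cartesianProduct⁺ (∈-allFin i) (∈-allFin j)) (<-≤-trans i<r r≤j , inj₁ (i<r , r≤j))
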